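{- Let $\beta\ge5$, $\epsilon_1\in\{0,1\}$ and $\epsilon_2\in\{1,-1\}$. (a) There is no tight chiral $4$-polytope of type $\{2^{\beta-1},2^\beta,8\}$ whose standard generators satisfy $\sigma_2\sigma_1^{ -1}=\sigma_1\sigma_2^{3-\epsilon_12^{\beta-1}}$ and $\sigma_2\sigma_3^2=\sigma_3^2\sigma_2^{1+\epsilon_22^{\beta-2}}$. (b) There is no tight chiral $4$-polytope of type $\{2^{\beta-1},2^\beta,2^{\beta-1}\}$ whose standard generators satisfy $\sigma_2\sigma_1^{ -1}=\sigma_1\sigma_2^{3-\epsilon_12^{\beta-1}}$, $\sigma_3^{ -1}\sigma_2=\sigma_2^{3+\epsilon_22^{\beta-2}}\sigma_3^{1-2^{\beta-2}}$ and $\sigma_3\sigma_2^{ -1}=\sigma_2^{ -3+\epsilon_22^{\beta-2}}\sigma_3^{ -1+2^{\beta-2}}$.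
   Context: For a chiral polytope with base flag $\Phi$, the standard generators $\sigma_1,\sigma_2,\sigma_3$ of its automorphism group are the automorphisms with $\Phi\sigma_i=\Phi^{i(i-1)}$, where $\Phi^j$ is the flag differing from $\Phi$ only in its $j$-face; for type $\{p,q,r\}$ they have orders $p,q,r$ and satisfy $(\sigma_1\sigma_2)^2=(\sigma_2\sigma_3)^2=(\sigma_1\sigma_2\sigma_3)^2=1$. Tight: type $\{p,q,r\}$ with exactly $2pqr$ flags. -}

module Defs where

open import Algebra.Bundles using (Group)
open import Data.Fin.Base using (Fin; toℕ)
open import Data.Integer.Base using (ℤ; +_; -[1+_])
open import Data.List.Base using (List; length; map)
open import Data.List.Membership.Propositional using (_∈_; _∉_)
open import Data.List.Membership.Propositional.Properties using (∈-map⁺)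
open import Data.List.Relation.Unary.All as All using (All)
open import Data.List.Relation.Unary.All.Properties using (map⁻)
open import Data.List.Relation.Unary.AllPairs as AllPairs using (AllPairs)
import Data.List.Relation.Unary.AllPairs.Properties as AllPairs
open import Data.Nat.Base as ℕ using (ℕ; zero; suc; pred; _+_; _*_; _∸_)
open import Data.Product.Base using (Σ-syntax; ∃-syntax; _×_; _,_)
open import Data.Sum.Base as Sum using (_⊎_)
open import Data.Vec.Base using (Vec; lookup; foldr)
open import Function.Base using (id; _∘_)
open import Function.Bundles using (_↔_; _⇔_; module Inverse)
open import Function.Construct.Composition using (_↔-∘_)
open import Function.Construct.Identity using (↔-id)
open import Function.Construct.Symmetry using (↔-sym)
open import Level using (0ℓ)
open import Relation.Binary.Construct.Closure.ReflexiveTransitive using (Star)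
open import Relation.Binary.Definitions using (Minimum; Maximum)
open import Relation.Binary.PropositionalEquality using (_≡_; _≢_; refl; sym; trans; cong; subst; subst₂)
open import Relation.Binary.Structures using (IsDecPartialOrder)
import Relation.Binary.Construct.NonStrictToStrict as ToStrict
open import Relation.Nullary.Negation using (¬_)

-- height F stands for rank F + 1, so the ranks −1, 0, …, n become the
-- heights 0, 1, …, n + 1, and a j-face is a face of height suc j.
record RankedPoset (n : ℕ) : Set₁ where
  infix 4 _≤_
  field
    Face              : Set
    _≤_               : Face → Face → Set
    isDecPartialOrder : IsDecPartialOrder _≡_ _≤_

  open IsDecPartialOrder isDecPartialOrder public
    using (_≟_; _≤?_; antisym) renaming (refl to ≤-refl; trans to ≤-trans)
  open ToStrict _≡_ _≤_ public using (_<_)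

  field
    height       : Face → ℕ
    height-bound : ∀ F → height F ℕ.≤ suc n
    height-mono  : ∀ {F G} → F < G → height F ℕ.< height G

module _ {n : ℕ} (R : RankedPoset n) where
  open RankedPoset R

  Incident : Face → Face → Set
  Incident F G = F ≤ G ⊎ G ≤ F

  -- A flag is a maximal chain.  Chains are finite because heights are bounded,
  -- so a chain is listed, uniquely, in strictly increasing order.  The proofs
  -- are irrelevant so that flags with the same faces are equal.
  record Flag : Set where
    constructor mkFlag
    field
      faces    : List Face
      .chain   : AllPairs _<_ faces
      .maximal : ∀ F → F ∉ faces → ¬ All (Incident F) faces

  open Flag

  -- The faces H of height h with F ≤ H ≤ G.
  record SectionFace (F G : Face) (h : ℕ) : Set where
    constructor mkSectionFace
    field
      face    : Face
      .lower  : F ≤ face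
      .upper  : face ≤ G
      .level  : height face ≡ h

  Adjacent : ℕ → Flag → Flag → Set
  Adjacent j Φ Ψ =
    Φ ≢ Ψ × (∀ F → height F ≢ suc j → (F ∈ faces Φ ⇔ F ∈ faces Ψ))

  ContainsMeet : Flag → Flag → Flag → Set
  ContainsMeet Φ Ψ X = ∀ F → F ∈ faces Φ → F ∈ faces Ψ → F ∈ faces X

  StronglyFlagConnected : Set
  StronglyFlagConnected = ∀ Φ Ψ →
    Star (λ X Y → (∃[ j ] Adjacent j X Y) × ContainsMeet Φ Ψ X × ContainsMeet Φ Ψ Y) Φ Ψ

  Diamond : Set
  Diamond = ∀ F G → F ≤ G → height G ≡ 2 + height F →
    SectionFace F G (1 + height F) ↔ Fin 2

  record IsPolytope : Set where
    field
      least       : Σ[ F ∈ Face ] Minimum _≤_ F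
      greatest    : Σ[ F ∈ Face ] Maximum _≤_ F
      flag-length : ∀ Φ → length (faces Φ) ≡ 2 + n
      diamond     : Diamond
      connected   : StronglyFlagConnected

record Polytope (n : ℕ) : Set₁ where
  field
    rankedPoset : RankedPoset n
    isPolytope  : IsPolytope rankedPoset

  open RankedPoset rankedPoset public
  open IsPolytope isPolytope public

module _ {n : ℕ} (P : Polytope n) where
  open Polytope P
  open Flag

  private
    Flagₚ : Set
    Flagₚ = Flag rankedPoset

  record Automorphism : Set where
    field
      bijection : Face ↔ Face

    open Inverse bijection public using (to; from; strictlyInverseˡ; strictlyInverseʳ)

    field
      mono   : ∀ {F G} → F ≤ G → to F ≤ to G
      cancel : ∀ {F G} → to F ≤ to G → F ≤ G

  open Automorphism

  private
    from-mono : ∀ σ {F G} → F ≤ G → from σ F ≤ from σ G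
    from-mono σ {F} {G} = cancel σ ∘
      subst₂ _≤_ (sym (strictlyInverseˡ σ F)) (sym (strictlyInverseˡ σ G))

    from-cancel : ∀ σ {F G} → from σ F ≤ from σ G → F ≤ G
    from-cancel σ {F} {G} =
      subst₂ _≤_ (strictlyInverseˡ σ F) (strictlyInverseˡ σ G) ∘ mono σ

    to-injective : ∀ σ {F G} → to σ F ≡ to σ G → F ≡ G
    to-injective σ {F} {G} eq = trans (sym (strictlyInverseʳ σ F))
      (trans (cong (from σ) eq) (strictlyInverseʳ σ G))

  -- Automorphisms act on the right: σ ∙ τ is σ followed by τ.
  automorphismGroup : Group 0ℓ 0ℓ
  automorphismGroup = record
    { Carrier = Automorphism
    ; _≈_     = λ σ τ → ∀ F → to σ F ≡ to τ F
    ; _∙_     = λ σ τ → record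
      { bijection = bijection τ ↔-∘ bijection σ
      ; mono      = mono τ ∘ mono σ
      ; cancel    = cancel σ ∘ cancel τ
      }
    ; ε       = record { bijection = ↔-id Face ; mono = id ; cancel = id }
    ; _⁻¹     = λ σ → record
      { bijection = ↔-sym (bijection σ)
      ; mono      = from-mono σ
      ; cancel    = from-cancel σ
      }
    ; isGroup = record
      { isMonoid = record
        { isSemigroup = record
          { isMagma = record
            { isEquivalence = record
              { refl  = λ _ → refl
              ; sym   = λ p F → sym (p F)
              ; trans = λ p q F → trans (p F) (q F)
              }
            ; ∙-cong = λ {_} {σ′} {τ} p q F → trans (cong (to τ) (p F)) (q (to σ′ F))
            }
          ; assoc = λ _ _ _ _ → refl
          }
        ; identity = (λ _ _ → refl) , (λ _ _ → refl)
        }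
      ; inverse = strictlyInverseˡ , strictlyInverseʳ
      ; ⁻¹-cong = λ {σ} {τ} p F → to-injective τ
          (trans (sym (p (from σ F)))
          (trans (strictlyInverseˡ σ F) (sym (strictlyInverseˡ τ F))))
      }
    }

  infixl 7 _·_

  _·_ : Flagₚ → Automorphism → Flagₚ
  mkFlag Fs chain maximal · σ = mkFlag (map (to σ) Fs)
    (AllPairs.map⁺ (AllPairs.map (λ (F≤G , F≢G) → mono σ F≤G , F≢G ∘ to-injective σ) chain))
    (λ F F∉ incident → maximal (from σ F)
      (λ F∈ → F∉ (subst (_∈ map (to σ) Fs) (strictlyInverseˡ σ F) (∈-map⁺ (to σ) F∈)))
      (All.map (λ {G} → Sum.map
          (cancel σ ∘ subst (_≤ to σ G) (sym (strictlyInverseˡ σ F)))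
          (cancel σ ∘ subst (to σ G ≤_) (sym (strictlyInverseˡ σ F))))
        (map⁻ incident)))

  SameOrbit : Flagₚ → Flagₚ → Set
  SameOrbit Φ Ψ = ∃[ σ ] Φ · σ ≡ Ψ

  TwoFlagOrbits : Set
  TwoFlagOrbits = ∃[ Φ ] ∃[ Ψ ]
    (¬ SameOrbit Φ Ψ) × (∀ X → SameOrbit Φ X ⊎ SameOrbit Ψ X)

  IsChiral : Set
  IsChiral = TwoFlagOrbits ×
    (∀ j Φ Ψ → Adjacent rankedPoset j Φ Ψ → ¬ SameOrbit Φ Ψ)

  -- Sections of polytopes are polytopes, so a rank-2 section is a p-gon
  -- when it has p vertices and p edges.
  IsPolygonSection : Face → Face → ℕ → Set
  IsPolygonSection F G p =
    (SectionFace rankedPoset F G (1 + height F) ↔ Fin p) ×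
    (SectionFace rankedPoset F G (2 + height F) ↔ Fin p)

  -- Entry i (counted from 0) of the vector is p_{i+1}, which governs the sections
  -- G/F with F an (i−1)-face and G an (i+2)-face.
  HasType : Vec ℕ (n ∸ 1) → Set
  HasType ps = ∀ i F G → F ≤ G → height F ≡ toℕ i → height G ≡ 3 + toℕ i →
    IsPolygonSection F G (lookup ps i)

  IsTightOfType : Vec ℕ (n ∸ 1) → Set
  IsTightOfType ps =
    HasType ps × (Flagₚ ↔ Fin (2 * foldr (λ _ → ℕ) _*_ 1 ps))

  -- Φσ = Φ^{i(i−1)} = (Φ^i)^{i−1}, for i ≥ 1; the intermediate flag Ψ is Φ^i.
  IsStandardGenerator : Flagₚ → ℕ → Automorphism → Set
  IsStandardGenerator Φ i σ = ∃[ Ψ ]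
    Adjacent rankedPoset i Φ Ψ × Adjacent rankedPoset (pred i) Ψ (Φ · σ)

-- Standard generators of a 4-polytope with respect to the base flag Φ.
StandardGenerators : (P : Polytope 4) → Flag (Polytope.rankedPoset P) →
  (σ₁ σ₂ σ₃ : Automorphism P) → Set
StandardGenerators P Φ σ₁ σ₂ σ₃ =
  IsStandardGenerator P Φ 1 σ₁ ×
  IsStandardGenerator P Φ 2 σ₂ ×
  IsStandardGenerator P Φ 3 σ₃

module IntegerPower {c ℓ} (G : Group c ℓ) where
  open Group G
  open import Algebra.Definitions.RawMonoid rawMonoid using () renaming (_×_ to _times_)

  infixr 8 _^ᶻ_

  _^ᶻ_ : Carrier → ℤ → Carrier
  x ^ᶻ (+ k)    = k times x
  x ^ᶻ -[1+ k ] = (suc k times x) ⁻¹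

module _ {n : ℕ} {P : Polytope n} where
  open Group (automorphismGroup P) public using (_≈_; _∙_; _⁻¹)
  open IntegerPower (automorphismGroup P) public using (_^ᶻ_)

-- "There is no tight chiral 4-polytope of type ps whose standard generators,
-- for some base flag, satisfy the given relations."
NoTightChiral : Vec ℕ 3 →
  ((P : Polytope 4) (σ₁ σ₂ σ₃ : Automorphism P) → Set) → Set₁
NoTightChiral ps Relations = ¬ (Σ[ P ∈ Polytope 4 ] IsChiral P × IsTightOfType P ps ×
  (Σ[ Φ ∈ Flag (Polytope.rankedPoset P) ]
   Σ[ σ₁ ∈ Automorphism P ] Σ[ σ₂ ∈ Automorphism P ] Σ[ σ₃ ∈ Automorphism P ]
     StandardGenerators P Φ σ₁ σ₂ σ₃ × Relations P σ₁ σ₂ σ₃))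

{-# OPTIONS --safe #-}

-- Write a, b, c for σ₁, σ₂, σ₃, let w = b^(2^(β−2)), ω = w^ε₂ and z = w².  In a
-- chiral polytope of type {p, q, r} the element b has order exactly q, since it
-- rotates a q-gonal section, so it is enough to derive z = 1 from the relations.
-- The relation between a and b says that a fixes b² up to ζ ∈ {1, z}, whereas c
-- sends a to a b² and b² (or b⁻²) to b² ω u, with u = c⁴ in part (a) and
-- u = c^(2^(β−2)) in part (b).  This u commutes with b² but u a u⁻¹ = a z, so
-- conjugating the relation a b² a⁻¹ = b² ζ by c gives z = 1.
module Submission where

import Defs
open Defs hiding (_≈_; _∙_; _⁻¹; _^ᶻ_)
open import Algebra.Bundles using (Group)
open import Data.Fin.Base as Fin using (Fin; toℕ; fromℕ<)
open import Data.Fin.Patterns using (0F; 1F; 2F)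
import Data.Fin.Properties as Fin
open import Data.Integer.Base as ℤ using (ℤ; +_; -[1+_]; 0ℤ; 1ℤ; -1ℤ)
import Data.Integer.Properties as ℤ
open import Data.List.Base using (List; []; _∷_; length; map; applyUpTo)
open import Data.List.Membership.Propositional using (_∈_; _∉_)
open import Data.List.Membership.Propositional.Properties using (∈-applyUpTo⁺)
open import Data.List.Properties using (map-∘; map-id; map-cong)
open import Data.List.Relation.Unary.All as All using (All)
open import Data.List.Relation.Unary.AllPairs using (AllPairs; []; _∷_; allPairs?)
import Data.List.Relation.Unary.AllPairs.Properties as AllPairs
open import Data.List.Relation.Unary.Any using (here; there)
open import Data.Nat.Base as ℕ using (ℕ; zero; suc; z≤n; s≤s; z<s; s<s; s<s⁻¹; _∸_; _^_)
import Data.Nat.Properties as ℕ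
import Data.Nat.Solver
open import Data.Product.Base using (∃-syntax; _×_; _,_; proj₁; proj₂)
open import Data.Sum.Base using (_⊎_; inj₁; inj₂)
open import Data.Vec.Base using (Vec; _∷_; []; lookup)
open import Function.Base using (_∘_)
open import Function.Bundles using (_↔_; mk⇔; module Inverse; module Equivalence)
open import Level using (0ℓ)
open import Relation.Binary.Construct.Closure.ReflexiveTransitive using (Star; _◅_) renaming (ε to done)
open import Relation.Binary.Definitions using (tri<; tri≈; tri>)
open import Relation.Binary.PropositionalEquality as ≡ using (_≡_; _≢_)
open import Relation.Nullary.Decidable using (Dec; yes; no; recompute; _×-dec_; ¬?)
open import Relation.Nullary.Negation using (¬_; contradiction)

-- Since β ≥ 5, both ω and ζ are powers of b⁸. Conjugation by a, c², c or u changes b² (or, for c in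
-- part (a), the passage from b⁻² to b²) only by commuting factors whose fourth power is trivial.
-- Hence b⁸ = (b²)⁴ is fixed, or inverted by c in part (a), and this is what controls ω, ζ and z
-- throughout. The equation u a u⁻¹ = a z carries the contradiction. In part (a) it comes from
-- conjugating a by c four times. In part (b) the two relations between b and c must give inverse
-- images of b² and b⁻²; this forces u b⁻¹ u⁻¹ = b⁻¹ z, and u commutes with ab. On the geometric
-- side, the type only counts the faces of a section. The count becomes an order because an
-- automorphism is determined by the image of one flag, and because strong flag connectedness lets
-- ⟨σ⟩ reach every face of the section.

private module NS = Data.Nat.Solver.+-*-Solver

-- Conjugation and integer powers in an arbitrary group.

module Semiconjugation {g ℓ} (G : Group g ℓ) where
  open Group G
  open import Algebra.Properties.Group G
  open import Algebra.Properties.Monoid.Mult monoid public renaming (_×_ to _times_)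
  open import Algebra.Solver.Monoid monoid using (solve; _⊕_; _⊜_; id)
  open import Relation.Binary.Reasoning.Setoid setoid
  open IntegerPower G using (_^ᶻ_)

  private variable
    h h′ x x′ y y′ z : Carrier

  infix 4 _∶_↦_

  -- This is h x h⁻¹ = y freed of inverses, so that products, powers and composites of conjugations
  -- need no cancellation.
  _∶_↦_ : Carrier → Carrier → Carrier → Set ℓ
  h ∶ x ↦ y = h ∙ x ≈ y ∙ h

  Commutes : Carrier → Carrier → Set ℓ
  Commutes x y = x ∶ y ↦ y

  ↦-resp : x ≈ x′ → y ≈ y′ → h ∶ x ↦ y → h ∶ x′ ↦ y′
  ↦-resp x≈x′ y≈y′ p = trans (∙-congˡ (sym x≈x′)) (trans p (∙-congʳ y≈y′))

  ↦-congˡ : h ≈ h′ → h ∶ x ↦ y → h′ ∶ x ↦ y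
  ↦-congˡ h≈h′ p = trans (∙-congʳ (sym h≈h′)) (trans p (∙-congˡ h≈h′))

  ↦-∙ : h ∶ x ↦ y → h ∶ x′ ↦ y′ → h ∶ x ∙ x′ ↦ y ∙ y′
  ↦-∙ {h} {x} {y} {x′} {y′} p q = begin
    h ∙ (x ∙ x′)   ≈⟨ assoc h x x′ ⟨
    (h ∙ x) ∙ x′   ≈⟨ ∙-congʳ p ⟩
    (y ∙ h) ∙ x′   ≈⟨ assoc y h x′ ⟩
    y ∙ (h ∙ x′)   ≈⟨ ∙-congˡ q ⟩
    y ∙ (y′ ∙ h)   ≈⟨ assoc y y′ h ⟨
    (y ∙ y′) ∙ h   ∎

  ↦-∘ : h′ ∶ y ↦ z → h ∶ x ↦ y → h′ ∙ h ∶ x ↦ z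
  ↦-∘ {h′} {y} {z} {h} {x} q p = begin
    (h′ ∙ h) ∙ x   ≈⟨ assoc h′ h x ⟩
    h′ ∙ (h ∙ x)   ≈⟨ ∙-congˡ p ⟩
    h′ ∙ (y ∙ h)   ≈⟨ assoc h′ y h ⟨
    (h′ ∙ y) ∙ h   ≈⟨ ∙-congʳ q ⟩
    (z ∙ h′) ∙ h   ≈⟨ assoc z h′ h ⟩
    z ∙ (h′ ∙ h)   ∎

  -- Conjugation by h is a function. Two computations of one image therefore give an equation, which
  -- is how every new relation below arises.
  ↦-unique : h ∶ x ↦ y → h ∶ x′ ↦ y′ → x ≈ x′ → y ≈ y′
  ↦-unique {h} p q x≈x′ = ∙-cancelʳ h _ _ (trans (sym p) (trans (∙-congˡ x≈x′) q))

  ↦-ε : h ∶ ε ↦ ε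
  ↦-ε {h} = trans (identityʳ h) (sym (identityˡ h))

  ↦-⁻¹ : h ∶ x ↦ y → h ∶ x ⁻¹ ↦ y ⁻¹
  ↦-⁻¹ {h} {x} {y} p = ∙-cancelˡ y _ _ (begin
    y ∙ (h ∙ x ⁻¹)   ≈⟨ assoc y h _ ⟨
    (y ∙ h) ∙ x ⁻¹   ≈⟨ ∙-congʳ p ⟨
    (h ∙ x) ∙ x ⁻¹   ≈⟨ //-rightDividesʳ x h ⟩
    h                ≈⟨ \\-leftDividesˡ y h ⟨
    y ∙ (y ⁻¹ ∙ h)   ∎)

  ↦-flip : h ∶ x ↦ y → h ⁻¹ ∶ y ↦ x
  ↦-flip {h} {x} {y} p = ∙-cancelˡ h _ _ (begin
    h ∙ (h ⁻¹ ∙ y)   ≈⟨ \\-leftDividesˡ h y ⟩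
    y                ≈⟨ //-rightDividesʳ h y ⟨
    (y ∙ h) ∙ h ⁻¹   ≈⟨ ∙-congʳ p ⟨
    (h ∙ x) ∙ h ⁻¹   ≈⟨ assoc h x _ ⟩
    h ∙ (x ∙ h ⁻¹)   ∎)

  ↦-times : ∀ n → h ∶ x ↦ y → h ∶ n times x ↦ n times y
  ↦-times zero    p = ↦-ε
  ↦-times (suc n) p = ↦-∙ p (↦-times n p)

  ∙-interchange-comm : Commutes x y → (x ∙ y) ∙ (x ∙ y) ≈ (x ∙ x) ∙ (y ∙ y)
  ∙-interchange-comm {x} {y} xy = begin
    (x ∙ y) ∙ (x ∙ y)   ≈⟨ solve 2 (λ x y → (x ⊕ y) ⊕ (x ⊕ y) ⊜ x ⊕ ((y ⊕ x) ⊕ y)) refl x y ⟩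
    x ∙ ((y ∙ x) ∙ y)   ≈⟨ ∙-congˡ (∙-congʳ xy) ⟨
    x ∙ ((x ∙ y) ∙ y)   ≈⟨ solve 2 (λ x y → x ⊕ ((x ⊕ y) ⊕ y) ⊜ (x ⊕ x) ⊕ (y ⊕ y)) refl x y ⟩
    (x ∙ x) ∙ (y ∙ y)   ∎

  [xy]²≈ε⇒yxy≈x⁻¹ : (x ∙ y) ∙ (x ∙ y) ≈ ε → (y ∙ x) ∙ y ≈ x ⁻¹
  [xy]²≈ε⇒yxy≈x⁻¹ {x} {y} p = inverseʳ-unique x _
    (trans (solve 2 (λ x y → x ⊕ ((y ⊕ x) ⊕ y) ⊜ (x ⊕ y) ⊕ (x ⊕ y)) refl x y) p)

  times-⁻¹ : ∀ n x → n times (x ⁻¹) ≈ (n times x) ⁻¹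
  times-⁻¹ zero    x = sym ε⁻¹≈ε
  times-⁻¹ (suc n) x = begin
    x ⁻¹ ∙ n times (x ⁻¹)   ≈⟨ ∙-congˡ (times-⁻¹ n x) ⟩
    x ⁻¹ ∙ (n times x) ⁻¹   ≈⟨ ⁻¹-anti-homo-∙ _ x ⟨
    (n times x ∙ x) ⁻¹      ≈⟨ ⁻¹-cong (↦-times n refl) ⟨
    (x ∙ n times x) ⁻¹      ∎

  ^ᶻ-neg : ∀ x i → x ^ᶻ (ℤ.- i) ≈ (x ^ᶻ i) ⁻¹
  ^ᶻ-neg x (+ zero)    = sym ε⁻¹≈ε
  ^ᶻ-neg x (+ suc n)   = refl
  ^ᶻ-neg x -[1+ n ]    = sym (⁻¹-involutive _)

  ^ᶻ-⊖ : ∀ x m n → x ^ᶻ (m ℤ.⊖ n) ≈ m times x ∙ (n times x) ⁻¹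
  ^ᶻ-⊖ x m       zero    = sym (trans (∙-congˡ ε⁻¹≈ε) (identityʳ _))
  ^ᶻ-⊖ x zero    (suc n) = sym (identityˡ _)
  ^ᶻ-⊖ x (suc m) (suc n) rewrite ℤ.[1+m]⊖[1+n]≡m⊖n m n = begin
    x ^ᶻ (m ℤ.⊖ n)                               ≈⟨ ^ᶻ-⊖ x m n ⟩
    m times x ∙ (n times x) ⁻¹                   ≈⟨ ∙-congʳ (//-rightDividesʳ x _) ⟨
    ((m times x ∙ x) ∙ x ⁻¹) ∙ (n times x) ⁻¹    ≈⟨ assoc _ _ _ ⟩
    (m times x ∙ x) ∙ (x ⁻¹ ∙ (n times x) ⁻¹)    ≈⟨ ∙-cong (↦-times m refl) (⁻¹-anti-homo-∙ _ x) ⟨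
    (x ∙ m times x) ∙ (n times x ∙ x) ⁻¹         ≈⟨ ∙-congˡ (⁻¹-cong (↦-times n refl)) ⟨
    (x ∙ m times x) ∙ (x ∙ n times x) ⁻¹         ∎

  ^ᶻ-homo-+ : ∀ x i j → x ^ᶻ (i ℤ.+ j) ≈ x ^ᶻ i ∙ x ^ᶻ j
  ^ᶻ-homo-+ x (+ m)    (+ n)    = ×-homo-+ x m n
  ^ᶻ-homo-+ x (+ m)    -[1+ n ] = ^ᶻ-⊖ x m (suc n)
  ^ᶻ-homo-+ x -[1+ m ] (+ n)    = begin
    x ^ᶻ (n ℤ.⊖ suc m)                 ≈⟨ ^ᶻ-⊖ x n (suc m) ⟩
    n times x ∙ (suc m times x) ⁻¹     ≈⟨ ↦-⁻¹ (↦-times (suc m) (sym (↦-times n refl))) ⟩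
    (suc m times x) ⁻¹ ∙ n times x     ∎
  ^ᶻ-homo-+ x -[1+ m ] -[1+ n ] = begin
    (suc (suc (m ℕ.+ n)) times x) ⁻¹             ≈⟨ ⁻¹-cong (×-congˡ (≡.cong suc
                                                      (≡.trans (≡.cong suc (ℕ.+-comm m n)) (≡.sym (ℕ.+-suc n m))))) ⟩
    ((suc n ℕ.+ suc m) times x) ⁻¹               ≈⟨ ⁻¹-cong (×-homo-+ x (suc n) (suc m)) ⟩
    (suc n times x ∙ suc m times x) ⁻¹           ≈⟨ ⁻¹-anti-homo-∙ _ _ ⟩
    (suc m times x) ⁻¹ ∙ (suc n times x) ⁻¹      ∎

-- The collapse z = 1 in an abstract group.

module _ {g ℓ} (G : Group g ℓ) where
  open Group G
  open Semiconjugation G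

  module Collapse
    (a b c ζ ω : Carrier) (l k : ℕ)
    (ζ-power : ζ ≈ l times (8 times b)) (ζ²≈ε : ζ ∙ ζ ≈ ε)
    (ω-power : ω ≈ k times (8 times b)) (ω⁴≈ε : (ω ∙ ω) ∙ (ω ∙ ω) ≈ ε)
    ([ab]²≈ε : (a ∙ b) ∙ (a ∙ b) ≈ ε)
    ([bc]²≈ε : (b ∙ c) ∙ (b ∙ c) ≈ ε)
    ([abc]²≈ε : ((a ∙ b) ∙ c) ∙ ((a ∙ b) ∙ c) ≈ ε)
    (ba⁻¹ : b ∙ a ⁻¹ ≈ a ∙ ((b ∙ (b ∙ b)) ∙ ζ))
    where

    open import Algebra.Properties.Group G
    open import Algebra.Solver.Monoid monoid using (solve; _⊕_; _⊜_; id)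
    open import Relation.Binary.Reasoning.Setoid setoid

    private
      b² b⁴ b⁸ b⁻² z : Carrier
      b² = b ∙ b
      b⁴ = b² ∙ b²
      b⁸ = b⁴ ∙ b⁴
      b⁻² = b ⁻¹ ∙ b ⁻¹
      z = ω ∙ ω

      8b≈b⁸ : 8 times b ≈ b⁸
      8b≈b⁸ = solve 1 (λ x → x ⊕ (x ⊕ (x ⊕ (x ⊕ (x ⊕ (x ⊕ (x ⊕ (x ⊕ id)))))))
        ⊜ ((x ⊕ x) ⊕ (x ⊕ x)) ⊕ ((x ⊕ x) ⊕ (x ⊕ x))) refl b

      -- Commuting with ω or ζ is never checked directly: it is inherited from b⁸, of which both are
      -- powers.
      ω↦ω : ∀ {h} → Commutes h b⁸ → Commutes h ω
      ω↦ω p = ↦-resp (sym ω-power) (sym ω-power) (↦-times k (↦-resp (sym 8b≈b⁸) (sym 8b≈b⁸) p))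

      ζ↦ζ : ∀ {h} → Commutes h b⁸ → Commutes h ζ
      ζ↦ζ p = ↦-resp (sym ζ-power) (sym ζ-power) (↦-times l (↦-resp (sym 8b≈b⁸) (sym 8b≈b⁸) p))

      z↦z : ∀ {h} → Commutes h ω → Commutes h z
      z↦z p = ↦-∙ p p

      b⁸↦b⁸ : ∀ {h} → Commutes h b⁴ → Commutes h b⁸
      b⁸↦b⁸ p = ↦-∙ p p

      b-b⁸ : Commutes b b⁸
      b-b⁸ = b⁸↦b⁸ (↦-∙ (↦-∙ refl refl) (↦-∙ refl refl))

      b-ω : Commutes b ω
      b-ω = ω↦ω b-b⁸

      b-ζ : Commutes b ζ
      b-ζ = ζ↦ζ b-b⁸

      ω-b : Commutes ω b
      ω-b = sym b-ω

      ω-b² : Commutes ω b²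
      ω-b² = ↦-∙ ω-b ω-b

      ω-ζ : Commutes ω ζ
      ω-ζ = ζ↦ζ (b⁸↦b⁸ (↦-∙ ω-b² ω-b²))

      b-z : Commutes b z
      b-z = z↦z b-ω

      b²-ω : Commutes b² ω
      b²-ω = sym ω-b²

      b²-ζ : Commutes b² ζ
      b²-ζ = ↦-∘ b-ζ b-ζ

      z⁻¹≈z : z ⁻¹ ≈ z
      z⁻¹≈z = sym (inverseˡ-unique z z ω⁴≈ε)

      ζ⁻¹≈ζ : ζ ⁻¹ ≈ ζ
      ζ⁻¹≈ζ = sym (inverseˡ-unique ζ ζ ζ²≈ε)

      b⁻²≈ : b⁻² ≈ b² ⁻¹
      b⁻²≈ = sym (⁻¹-anti-homo-∙ b b)

      bc≈ : b ∙ c ≈ c ⁻¹ ∙ b ⁻¹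
      bc≈ = trans (inverseˡ-unique _ _ [bc]²≈ε) (⁻¹-anti-homo-∙ b c)

      bab≈a⁻¹ : (b ∙ a) ∙ b ≈ a ⁻¹
      bab≈a⁻¹ = [xy]²≈ε⇒yxy≈x⁻¹ [ab]²≈ε

      cbc≈b⁻¹ : (c ∙ b) ∙ c ≈ b ⁻¹
      cbc≈b⁻¹ = [xy]²≈ε⇒yxy≈x⁻¹ [bc]²≈ε

      cabc≈ab : (c ∙ (a ∙ b)) ∙ c ≈ a ∙ b
      cabc≈ab = trans ([xy]²≈ε⇒yxy≈x⁻¹ [abc]²≈ε) (sym (inverseˡ-unique _ _ [ab]²≈ε))

      -- Substituting a⁻¹ = bab on the left of a⁻¹(b²ζ) gives b · ab³ζ, which is b · ba⁻¹ by
      -- hypothesis.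
      a∶b²↦b²ζ : a ∶ b² ↦ b² ∙ ζ
      a∶b²↦b²ζ = ↦-congˡ (⁻¹-involutive a) (↦-flip (begin
        a ⁻¹ ∙ (b² ∙ ζ)               ≈⟨ ∙-congʳ bab≈a⁻¹ ⟨
        ((b ∙ a) ∙ b) ∙ (b² ∙ ζ)      ≈⟨ solve 3 (λ a b ζ → ((b ⊕ a) ⊕ b) ⊕ ((b ⊕ b) ⊕ ζ)
                                          ⊜ b ⊕ (a ⊕ ((b ⊕ (b ⊕ b)) ⊕ ζ))) refl a b ζ ⟩
        b ∙ (a ∙ ((b ∙ b²) ∙ ζ))      ≈⟨ ∙-congˡ ba⁻¹ ⟨
        b ∙ (b ∙ a ⁻¹)                ≈⟨ assoc b b _ ⟨
        b² ∙ a ⁻¹                     ∎))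

      a-b⁸ : Commutes a b⁸
      a-b⁸ = b⁸↦b⁸ (↦-resp refl b²ζb²ζ≈b⁴ (↦-∙ a∶b²↦b²ζ a∶b²↦b²ζ))
        where
        b²ζb²ζ≈b⁴ : (b² ∙ ζ) ∙ (b² ∙ ζ) ≈ b⁴
        b²ζb²ζ≈b⁴ = trans (∙-interchange-comm b²-ζ) (trans (∙-congˡ ζ²≈ε) (identityʳ b⁴))

      a-ω : Commutes a ω
      a-ω = ω↦ω a-b⁸

      a-z : Commutes a z
      a-z = z↦z a-ω

      -- Writing a = (ab)b⁻¹ brings in c(ab)c = ab, and the leftover c⁻¹b⁻¹ is bc.
      c∶a↦ab² : c ∶ a ↦ a ∙ b²
      c∶a↦ab² = begin
        c ∙ a                                     ≈⟨ ∙-congˡ (//-rightDividesʳ b a) ⟨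
        c ∙ ((a ∙ b) ∙ b ⁻¹)                      ≈⟨ assoc c _ _ ⟨
        (c ∙ (a ∙ b)) ∙ b ⁻¹                      ≈⟨ ∙-congʳ (//-rightDividesʳ c _) ⟨
        (((c ∙ (a ∙ b)) ∙ c) ∙ c ⁻¹) ∙ b ⁻¹       ≈⟨ assoc _ _ _ ⟩
        ((c ∙ (a ∙ b)) ∙ c) ∙ (c ⁻¹ ∙ b ⁻¹)       ≈⟨ ∙-cong cabc≈ab (sym bc≈) ⟩
        (a ∙ b) ∙ (b ∙ c)                         ≈⟨ solve 3 (λ a b c → (a ⊕ b) ⊕ (b ⊕ c) ⊜ (a ⊕ (b ⊕ b)) ⊕ c) refl a b c ⟩
        (a ∙ b²) ∙ c                              ∎

      -- Conjugate the relation a s = s ζ a by c.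
      collapse : ∀ {s u} → a ∶ s ↦ s ∙ ζ → c ∶ s ↦ (b² ∙ ω) ∙ u → c ∶ ζ ↦ ζ →
        Commutes u b² → u ∶ a ↦ a ∙ z → z ≈ ε
      collapse {s} {u} a∶s c∶s c∶ζ u-b² u∶a = sym (∙-cancelˡ (e ∙ ζ) _ _ (begin
        (e ∙ ζ) ∙ ε                        ≈⟨ identityʳ _ ⟩
        e ∙ ζ                              ≈⟨ eζ≈ ⟩
        ((b² ∙ ζ) ∙ ω) ∙ (u ∙ z)           ≈⟨ assoc _ u z ⟨
        (((b² ∙ ζ) ∙ ω) ∙ u) ∙ z           ≈⟨ ∙-congʳ b²ζωu≈eζ ⟩
        (e ∙ ζ) ∙ z                        ∎))
        where
        e : Carrier
        e = (b² ∙ ω) ∙ u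

        u-b⁸ : Commutes u b⁸
        u-b⁸ = b⁸↦b⁸ (↦-∙ u-b² u-b²)

        u-ζ : Commutes u ζ
        u-ζ = ζ↦ζ u-b⁸

        u-z : Commutes u z
        u-z = z↦z (ω↦ω u-b⁸)

        b²ζωu≈eζ : ((b² ∙ ζ) ∙ ω) ∙ u ≈ e ∙ ζ
        b²ζωu≈eζ = begin
          ((b² ∙ ζ) ∙ ω) ∙ u    ≈⟨ ∙-congʳ (assoc b² ζ ω) ⟩
          (b² ∙ (ζ ∙ ω)) ∙ u    ≈⟨ ∙-congʳ (∙-congˡ ω-ζ) ⟨
          (b² ∙ (ω ∙ ζ)) ∙ u    ≈⟨ solve 4 (λ b ω ζ u → (b ⊕ (ω ⊕ ζ)) ⊕ u ⊜ (b ⊕ ω) ⊕ (ζ ⊕ u)) refl b² ω ζ u ⟩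
          (b² ∙ ω) ∙ (ζ ∙ u)    ≈⟨ ∙-congˡ u-ζ ⟨
          (b² ∙ ω) ∙ (u ∙ ζ)    ≈⟨ assoc _ u ζ ⟨
          e ∙ ζ                 ∎

        -- As z is an involution commuting with a and u, the relation u a = a z u is symmetric in a
        -- and u.
        a∶u : a ∶ u ↦ u ∙ z
        a∶u = begin
          a ∙ u                 ≈⟨ identityʳ _ ⟨
          (a ∙ u) ∙ ε           ≈⟨ ∙-congˡ ω⁴≈ε ⟨
          (a ∙ u) ∙ (z ∙ z)     ≈⟨ solve 3 (λ a u z → (a ⊕ u) ⊕ (z ⊕ z) ⊜ a ⊕ ((u ⊕ z) ⊕ z)) refl a u z ⟩
          a ∙ ((u ∙ z) ∙ z)     ≈⟨ ∙-congˡ (∙-congʳ u-z) ⟩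
          a ∙ ((z ∙ u) ∙ z)     ≈⟨ solve 3 (λ a u z → a ⊕ ((z ⊕ u) ⊕ z) ⊜ ((a ⊕ z) ⊕ u) ⊕ z) refl a u z ⟩
          ((a ∙ z) ∙ u) ∙ z     ≈⟨ ∙-congʳ u∶a ⟨
          (u ∙ a) ∙ z           ≈⟨ assoc u a z ⟩
          u ∙ (a ∙ z)           ≈⟨ ∙-congˡ a-z ⟩
          u ∙ (z ∙ a)           ≈⟨ assoc u z a ⟨
          (u ∙ z) ∙ a           ∎

        a∶e : a ∶ e ↦ ((b² ∙ ζ) ∙ ω) ∙ (u ∙ z)
        a∶e = ↦-∙ (↦-∙ a∶b²↦b²ζ a-ω) a∶u

        e-b² : Commutes e b²
        e-b² = ↦-∘ (↦-∘ refl ω-b²) u-b²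

        conjugated : (a ∙ b²) ∙ e ≈ (e ∙ ζ) ∙ (a ∙ b²)
        -- Both sides of a s = s ζ a are pushed through c; the letter s becomes `e` and a becomes
        -- ab².
        conjugated = ↦-unique (↦-∙ c∶a↦ab² c∶s) (↦-∙ (↦-∙ c∶s c∶ζ) c∶a↦ab²) a∶s

        a∶e′ : a ∶ e ↦ e ∙ ζ
        -- Because `e` commutes with b², the extra b² moves to the right end on both sides and
        -- cancels.
        a∶e′ = ∙-cancelʳ b² _ _ (begin
          (a ∙ e) ∙ b²           ≈⟨ assoc a e b² ⟩
          a ∙ (e ∙ b²)           ≈⟨ ∙-congˡ e-b² ⟩
          a ∙ (b² ∙ e)           ≈⟨ assoc a b² e ⟨
          (a ∙ b²) ∙ e           ≈⟨ conjugated ⟩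
          (e ∙ ζ) ∙ (a ∙ b²)     ≈⟨ assoc _ a b² ⟨
          ((e ∙ ζ) ∙ a) ∙ b²     ∎)

        eζ≈ : e ∙ ζ ≈ ((b² ∙ ζ) ∙ ω) ∙ (u ∙ z)
        -- The image of `e` under a, found once by conjugation with c and once factor by factor,
        -- differs by exactly one z.
        eζ≈ = ↦-unique a∶e′ a∶e refl

    -- Part (a): the hypotheses are c⁸ = 1 and the relation between σ₂ and σ₃².
    module _ (d⁴≈ε : ((c ∙ c) ∙ (c ∙ c)) ∙ ((c ∙ c) ∙ (c ∙ c)) ≈ ε)
             (bc² : b ∙ (c ∙ c) ≈ (c ∙ c) ∙ (b ∙ ω)) where

      private
        d D e u : Carrier
        d = c ∙ c
        D = d ∙ d
        e = (b² ∙ ω) ∙ D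
        -- This is c⁴ω; the `u` of `collapse` will be `D` = c⁴.
        u = D ∙ ω

        bω²≈b²z : (b ∙ ω) ∙ (b ∙ ω) ≈ b² ∙ z
        bω²≈b²z = ∙-interchange-comm b-ω

        -- By `bc²`, d conjugates bω to b; squaring turns ω into z.
        d∶b²z↦b² : d ∶ b² ∙ z ↦ b²
        d∶b²z↦b² = ↦-resp bω²≈b²z refl (↦-∙ (sym bc²) (sym bc²))

        b²-z : Commutes b² z
        b²-z = ↦-∘ b-z b-z

        d-b⁴ : Commutes d b⁴
        d-b⁴ = ↦-resp (trans (∙-interchange-comm b²-z) (trans (∙-congˡ ω⁴≈ε) (identityʳ b⁴))) refl
          (↦-∙ d∶b²z↦b² d∶b²z↦b²)

        d-ω : Commutes d ω
        d-ω = ω↦ω (b⁸↦b⁸ d-b⁴)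

        d∶b²↦b²z : d ∶ b² ↦ b² ∙ z
        d∶b²↦b²z = ↦-resp (trans (assoc b² z z) (trans (∙-congˡ ω⁴≈ε) (identityʳ b²))) refl
          (↦-∙ d∶b²z↦b² (z↦z d-ω))

        D-b² : Commutes D b²
        D-b² = ↦-∘ d∶b²z↦b² d∶b²↦b²z

        D-ω : Commutes D ω
        D-ω = ↦-∘ d-ω d-ω

        D-b²ω : Commutes D (b² ∙ ω)
        D-b²ω = ↦-∙ D-b² D-ω

        -- Multiplying cbc = b⁻¹ by c on the left gives c b⁻¹ = (c²b)c.
        c∶b⁻¹ : c ∶ b ⁻¹ ↦ d ∙ b
        c∶b⁻¹ = trans (∙-congˡ (sym cbc≈b⁻¹))
          (solve 2 (λ b c → c ⊕ ((c ⊕ b) ⊕ c) ⊜ ((c ⊕ c) ⊕ b) ⊕ c) refl b c)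

        -- In (db)² the inner d passes b at the cost of one ω, so the image is Dωb² up to order.
        c∶b⁻² : c ∶ b⁻² ↦ e
        c∶b⁻² = ↦-resp refl (begin
          (d ∙ b) ∙ (d ∙ b)           ≈⟨ solve 2 (λ d b → (d ⊕ b) ⊕ (d ⊕ b) ⊜ d ⊕ ((b ⊕ d) ⊕ b)) refl d b ⟩
          d ∙ ((b ∙ d) ∙ b)           ≈⟨ ∙-congˡ (∙-congʳ bc²) ⟩
          d ∙ ((d ∙ (b ∙ ω)) ∙ b)     ≈⟨ solve 3 (λ d b ω → d ⊕ ((d ⊕ (b ⊕ ω)) ⊕ b) ⊜ (d ⊕ d) ⊕ (b ⊕ (ω ⊕ b))) refl d b ω ⟩
          D ∙ (b ∙ (ω ∙ b))           ≈⟨ ∙-congˡ (∙-congˡ ω-b) ⟩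
          D ∙ (b ∙ (b ∙ ω))           ≈⟨ ∙-congˡ (assoc b b ω) ⟨
          D ∙ (b² ∙ ω)                ≈⟨ D-b²ω ⟩
          e                           ∎) (↦-∙ c∶b⁻¹ c∶b⁻¹)

        e²≈b⁴z : e ∙ e ≈ b⁴ ∙ z
        e²≈b⁴z = trans (∙-interchange-comm (sym D-b²ω)) (trans (∙-cong (∙-interchange-comm b²-ω) d⁴≈ε) (identityʳ _))

        e⁴≈b⁸ : (e ∙ e) ∙ (e ∙ e) ≈ b⁸
        e⁴≈b⁸ = trans (∙-cong e²≈b⁴z e²≈b⁴z)
          (trans (∙-interchange-comm (↦-∘ b²-z b²-z)) (trans (∙-congˡ ω⁴≈ε) (identityʳ b⁸)))

        b⁻⁸≈ : (b⁻² ∙ b⁻²) ∙ (b⁻² ∙ b⁻²) ≈ b⁸ ⁻¹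
        b⁻⁸≈ = begin
          (b⁻² ∙ b⁻²) ∙ (b⁻² ∙ b⁻²)                    ≈⟨ ∙-cong b⁻⁴≈ b⁻⁴≈ ⟩
          b⁴ ⁻¹ ∙ b⁴ ⁻¹                                ≈⟨ ⁻¹-anti-homo-∙ b⁴ b⁴ ⟨
          b⁸ ⁻¹                                        ∎
          where
          b⁻⁴≈ : b⁻² ∙ b⁻² ≈ b⁴ ⁻¹
          b⁻⁴≈ = trans (∙-cong b⁻²≈ b⁻²≈) (sym (⁻¹-anti-homo-∙ b² b²))

        -- The fourth power of b⁻² ↦ e is b⁻⁸ ↦ b⁸, so c inverts b⁸. It thus fixes the involutory
        -- power ζ.
        c∶b⁸ : c ∶ 8 times b ↦ (8 times b) ⁻¹
        c∶b⁸ = ↦-resp (trans (⁻¹-involutive _) (sym 8b≈b⁸)) (⁻¹-cong (trans e⁴≈b⁸ (sym 8b≈b⁸)))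
          (↦-⁻¹ (↦-resp b⁻⁸≈ refl (↦-∙ (↦-∙ c∶b⁻² c∶b⁻²) (↦-∙ c∶b⁻² c∶b⁻²))))

        c∶ζ : c ∶ ζ ↦ ζ
        c∶ζ = ↦-resp (sym ζ-power) (begin
          l times ((8 times b) ⁻¹)    ≈⟨ times-⁻¹ l _ ⟩
          (l times (8 times b)) ⁻¹    ≈⟨ ⁻¹-cong ζ-power ⟨
          ζ ⁻¹                        ≈⟨ ζ⁻¹≈ζ ⟩
          ζ                           ∎) (↦-times l c∶b⁸)

        c∶b² : c ∶ b² ↦ e ⁻¹
        c∶b² = ↦-resp (trans (⁻¹-cong b⁻²≈) (⁻¹-involutive b²)) refl (↦-⁻¹ c∶b⁻²)

        -- Two conjugations by c send a to ab² and then to ab²e⁻¹, where e = ub² cancels the b².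
        d∶a : d ∶ a ↦ a ∙ u ⁻¹
        d∶a = ↦-resp refl (begin
          (a ∙ b²) ∙ e ⁻¹                ≈⟨ ∙-congˡ (⁻¹-cong e≈ub²) ⟩
          (a ∙ b²) ∙ (u ∙ b²) ⁻¹         ≈⟨ ∙-congˡ (⁻¹-anti-homo-∙ u b²) ⟩
          (a ∙ b²) ∙ (b² ⁻¹ ∙ u ⁻¹)      ≈⟨ assoc _ _ _ ⟨
          ((a ∙ b²) ∙ b² ⁻¹) ∙ u ⁻¹      ≈⟨ ∙-congʳ (//-rightDividesʳ b² a) ⟩
          a ∙ u ⁻¹                       ∎) (↦-∘ (↦-∙ c∶a↦ab² c∶b²) c∶a↦ab²)
          where
          e≈ub² : e ≈ u ∙ b²
          e≈ub² = trans (sym D-b²ω) (trans (∙-congˡ b²-ω) (sym (assoc D ω b²)))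

        -- As d fixes u, conjugating a by d twice contributes u⁻², and u² = D²ω² = z because D² = c⁸
        -- = 1.
        D∶a : D ∶ a ↦ a ∙ z
        D∶a = ↦-resp refl (begin
          (a ∙ u ⁻¹) ∙ u ⁻¹      ≈⟨ assoc a _ _ ⟩
          a ∙ (u ⁻¹ ∙ u ⁻¹)      ≈⟨ ∙-congˡ (⁻¹-anti-homo-∙ u u) ⟨
          a ∙ (u ∙ u) ⁻¹         ≈⟨ ∙-congˡ (⁻¹-cong u²≈z) ⟩
          a ∙ z ⁻¹               ≈⟨ ∙-congˡ z⁻¹≈z ⟩
          a ∙ z                  ∎) (↦-∘ (↦-∙ d∶a (↦-⁻¹ d-u)) d∶a)
          where
          u²≈z : u ∙ u ≈ z
          u²≈z = trans (∙-interchange-comm D-ω) (trans (∙-congʳ d⁴≈ε) (identityˡ z))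

          d-u : Commutes d u
          d-u = ↦-∙ (↦-∙ refl refl) d-ω

        a∶b⁻² : a ∶ b⁻² ↦ b⁻² ∙ ζ
        a∶b⁻² = ↦-resp (sym b⁻²≈) (begin
          (b² ∙ ζ) ⁻¹      ≈⟨ ⁻¹-cong b²-ζ ⟩
          (ζ ∙ b²) ⁻¹      ≈⟨ ⁻¹-anti-homo-∙ ζ b² ⟩
          b² ⁻¹ ∙ ζ ⁻¹     ≈⟨ ∙-cong (sym b⁻²≈) ζ⁻¹≈ζ ⟩
          b⁻² ∙ ζ          ∎) (↦-⁻¹ a∶b²↦b²ζ)

      collapse-a : z ≈ ε
      collapse-a = collapse a∶b⁻² c∶b⁻² c∶ζ D-b² D∶a

    -- Here v is c^(2^(β−2)), and the hypothesis on m makes 3 invertible modulo the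
    -- order of b.
    module _ (v : Carrier) (n m : ℕ) (v-power : v ≈ n times c) (v²≈ε : v ∙ v ≈ ε)
             (b¹²ᵐ⁺⁴≈ε : 4 times b ∙ m times (12 times b) ≈ ε)
             (c⁻¹b : c ⁻¹ ∙ b ≈ ((b ∙ b ∙ b) ∙ ω) ∙ (c ∙ v))
             (cb⁻¹ : c ∙ b ⁻¹ ≈ ((b ∙ b ∙ b) ⁻¹ ∙ ω) ∙ (c ⁻¹ ∙ v)) where
      private
        b³ e : Carrier
        b³ = b ∙ b ∙ b
        e = (b² ∙ ω) ∙ v

        c-v : Commutes c v
        c-v = ↦-resp (sym v-power) (sym v-power) (↦-times n refl)

        v⁻¹≈v : v ⁻¹ ≈ v
        v⁻¹≈v = sym (inverseˡ-unique v v v²≈ε)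

        cb≈ : c ∙ b ≈ b ⁻¹ ∙ c ⁻¹
        cb≈ = trans (sym (//-rightDividesʳ c _)) (∙-congʳ cbc≈b⁻¹)

        -- Here cb = b⁻¹c⁻¹ exposes c⁻¹b, to which the first relation applies.
        c∶b² : c ∶ b² ↦ e
        c∶b² = begin
          c ∙ b²                                 ≈⟨ assoc c b b ⟨
          (c ∙ b) ∙ b                            ≈⟨ ∙-congʳ cb≈ ⟩
          (b ⁻¹ ∙ c ⁻¹) ∙ b                      ≈⟨ assoc _ _ b ⟩
          b ⁻¹ ∙ (c ⁻¹ ∙ b)                      ≈⟨ ∙-congˡ c⁻¹b ⟩
          b ⁻¹ ∙ ((b³ ∙ ω) ∙ (c ∙ v))            ≈⟨ ∙-congˡ (∙-congˡ c-v) ⟩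
          b ⁻¹ ∙ ((b³ ∙ ω) ∙ (v ∙ c))            ≈⟨ ∙-congˡ (solve 4 (λ b ω v c → (((b ⊕ b) ⊕ b) ⊕ ω) ⊕ (v ⊕ c)
                                                      ⊜ b ⊕ ((((b ⊕ b) ⊕ ω) ⊕ v) ⊕ c)) refl b ω v c) ⟩
          b ⁻¹ ∙ (b ∙ (e ∙ c))                   ≈⟨ \\-leftDividesʳ b _ ⟩
          e ∙ c                                  ∎

        b³-ω : Commutes b³ ω
        b³-ω = ↦-∘ b²-ω b-ω

        c∶b⁻² : c ∶ b⁻² ↦ ((b³ ⁻¹ ∙ ω) ∙ v) ∙ b
        c∶b⁻² = begin
          c ∙ b⁻²                                         ≈⟨ assoc c _ _ ⟨
          (c ∙ b ⁻¹) ∙ b ⁻¹                               ≈⟨ ∙-congʳ cb⁻¹ ⟩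
          ((b³ ⁻¹ ∙ ω) ∙ (c ⁻¹ ∙ v)) ∙ b ⁻¹               ≈⟨ ∙-congʳ (∙-congˡ (↦-flip c-v)) ⟩
          ((b³ ⁻¹ ∙ ω) ∙ (v ∙ c ⁻¹)) ∙ b ⁻¹               ≈⟨ solve 4 (λ x v c b → (x ⊕ (v ⊕ c)) ⊕ b ⊜ (x ⊕ v) ⊕ (c ⊕ b)) refl (b³ ⁻¹ ∙ ω) v (c ⁻¹) (b ⁻¹) ⟩
          ((b³ ⁻¹ ∙ ω) ∙ v) ∙ (c ⁻¹ ∙ b ⁻¹)               ≈⟨ ∙-congˡ bc≈ ⟨
          ((b³ ⁻¹ ∙ ω) ∙ v) ∙ (b ∙ c)                     ≈⟨ assoc _ b c ⟨
          (((b³ ⁻¹ ∙ ω) ∙ v) ∙ b) ∙ c                     ∎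

        -- The two relations give the images of b² and of b⁻² under c separately. That these are
        -- inverse to each other is a consistency condition, and it determines how v acts on b³.
        b³≈ : b³ ≈ (ω ∙ v) ∙ ((b³ ∙ ω) ∙ v)
        b³≈ = ∙-cancelˡ (b³ ⁻¹) _ _ (begin
          b³ ⁻¹ ∙ b³                                      ≈⟨ inverseˡ b³ ⟩
          ε                                               ≈⟨ inverseˡ e ⟨
          e ⁻¹ ∙ e                                        ≈⟨ ∙-congʳ (↦-unique (↦-⁻¹ c∶b²) c∶b⁻² (sym b⁻²≈)) ⟩
          (((b³ ⁻¹ ∙ ω) ∙ v) ∙ b) ∙ ((b² ∙ ω) ∙ v)        ≈⟨ solve 4 (λ x ω v b → (((x ⊕ ω) ⊕ v) ⊕ b) ⊕ (((b ⊕ b) ⊕ ω) ⊕ v)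
                                                              ⊜ x ⊕ ((ω ⊕ v) ⊕ ((((b ⊕ b) ⊕ b) ⊕ ω) ⊕ v))) refl (b³ ⁻¹) ω v b ⟩
          b³ ⁻¹ ∙ ((ω ∙ v) ∙ ((b³ ∙ ω) ∙ v))              ∎)

        v∶b³ω : v ∶ b³ ∙ ω ↦ ω ⁻¹ ∙ b³
        v∶b³ω = begin
          v ∙ (b³ ∙ ω)                            ≈⟨ \\-leftDividesʳ ω _ ⟨
          ω ⁻¹ ∙ (ω ∙ (v ∙ (b³ ∙ ω)))             ≈⟨ identityʳ _ ⟨
          ω ⁻¹ ∙ (ω ∙ (v ∙ (b³ ∙ ω))) ∙ ε         ≈⟨ ∙-congˡ v²≈ε ⟨
          ω ⁻¹ ∙ (ω ∙ (v ∙ (b³ ∙ ω))) ∙ (v ∙ v)   ≈⟨ solve 4 (λ o ω v x → (o ⊕ (ω ⊕ (v ⊕ x))) ⊕ (v ⊕ v)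
                                                      ⊜ (o ⊕ ((ω ⊕ v) ⊕ (x ⊕ v))) ⊕ v) refl (ω ⁻¹) ω v (b³ ∙ ω) ⟩
          (ω ⁻¹ ∙ ((ω ∙ v) ∙ ((b³ ∙ ω) ∙ v))) ∙ v ≈⟨ ∙-congʳ (∙-congˡ b³≈) ⟨
          (ω ⁻¹ ∙ b³) ∙ v                         ∎

        12b≈ : (b³ ∙ b³) ∙ (b³ ∙ b³) ≈ 12 times b
        12b≈ = solve 1 (λ b → ((((b ⊕ b) ⊕ b) ⊕ ((b ⊕ b) ⊕ b)) ⊕ (((b ⊕ b) ⊕ b) ⊕ ((b ⊕ b) ⊕ b)))
          ⊜ b ⊕ (b ⊕ (b ⊕ (b ⊕ (b ⊕ (b ⊕ (b ⊕ (b ⊕ (b ⊕ (b ⊕ (b ⊕ (b ⊕ id)))))))))))) refl b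

        -- Conjugation by v takes b³ω to ω⁻¹b³. Fourth powers kill ω, which commutes with b, and
        -- leave b¹² on both sides.
        v-b¹² : Commutes v (12 times b)
        v-b¹² = ↦-resp source target (↦-∙ (↦-∙ v∶b³ω v∶b³ω) (↦-∙ v∶b³ω v∶b³ω))
          where
          fourth : ∀ {x y} → Commutes x y → ((x ∙ y) ∙ (x ∙ y)) ∙ ((x ∙ y) ∙ (x ∙ y)) ≈ ((x ∙ x) ∙ (x ∙ x)) ∙ ((y ∙ y) ∙ (y ∙ y))
          fourth p = trans (∙-cong (∙-interchange-comm p) (∙-interchange-comm p))
            (∙-interchange-comm (↦-∘ (↦-∙ p p) (↦-∙ p p)))

          source : ((b³ ∙ ω) ∙ (b³ ∙ ω)) ∙ ((b³ ∙ ω) ∙ (b³ ∙ ω)) ≈ 12 times b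
          source = trans (fourth b³-ω) (trans (∙-cong 12b≈ ω⁴≈ε) (identityʳ _))

          ω⁻⁴≈ε : ((ω ⁻¹) ∙ (ω ⁻¹)) ∙ ((ω ⁻¹) ∙ (ω ⁻¹)) ≈ ε
          ω⁻⁴≈ε = trans (∙-cong (sym (⁻¹-anti-homo-∙ ω ω)) (sym (⁻¹-anti-homo-∙ ω ω)))
            (trans (∙-cong z⁻¹≈z z⁻¹≈z) ω⁴≈ε)

          target : ((ω ⁻¹ ∙ b³) ∙ (ω ⁻¹ ∙ b³)) ∙ ((ω ⁻¹ ∙ b³) ∙ (ω ⁻¹ ∙ b³)) ≈ 12 times b
          target = trans (fourth (↦-flip (sym b³-ω))) (trans (∙-cong ω⁻⁴≈ε 12b≈) (identityˡ _))

        -- ω⁻¹ = ω³ is a power of b²⁴.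
        v-ω : Commutes v ω
        v-ω = ↦-resp (⁻¹-involutive ω) (⁻¹-involutive ω) (↦-⁻¹ (↦-resp ω³ ω³ (↦-times (2 ℕ.* k) v-b¹²)))
          where
          ω³ : (2 ℕ.* k) times (12 times b) ≈ ω ⁻¹
          ω³ = begin
            (2 ℕ.* k) times (12 times b)            ≈⟨ ×-assocˡ b (2 ℕ.* k) 12 ⟩
            (2 ℕ.* k ℕ.* 12) times b                ≈⟨ ×-congˡ (NS.solve 1 (λ k → NS.con 2 NS.:* k NS.:* NS.con 12
                                                          NS.:= NS.con 3 NS.:* (k NS.:* NS.con 8)) ≡.refl k) ⟩
            (3 ℕ.* (k ℕ.* 8)) times b               ≈⟨ ×-assocˡ b 3 (k ℕ.* 8) ⟨
            3 times ((k ℕ.* 8) times b)             ≈⟨ ×-congʳ 3 (trans ω-power (×-assocˡ b k 8)) ⟨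
            3 times ω                               ≈⟨ solve 1 (λ x → x ⊕ (x ⊕ (x ⊕ id)) ⊜ (x ⊕ x) ⊕ x) refl ω ⟩
            z ∙ ω                                   ≈⟨ inverseˡ-unique _ _ (trans (assoc z ω ω) ω⁴≈ε) ⟩
            ω ⁻¹                                    ∎

        v∶b³ : v ∶ b³ ↦ b³ ∙ z
        v∶b³ = ↦-resp (//-rightDividesʳ ω b³) (begin
          (ω ⁻¹ ∙ b³) ∙ ω ⁻¹       ≈⟨ ∙-congʳ (↦-flip (sym b³-ω)) ⟩
          (b³ ∙ ω ⁻¹) ∙ ω ⁻¹       ≈⟨ assoc b³ _ _ ⟩
          b³ ∙ (ω ⁻¹ ∙ ω ⁻¹)       ≈⟨ ∙-congˡ (⁻¹-anti-homo-∙ ω ω) ⟨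
          b³ ∙ z ⁻¹                ≈⟨ ∙-congˡ z⁻¹≈z ⟩
          b³ ∙ z                   ∎) (↦-∙ v∶b³ω (↦-⁻¹ v-ω))

        -- The hypothesis on m writes b⁻¹ as b³ · b¹²ᵐ, and v fixes the second factor, so the factor
        -- z of b³ passes to b⁻¹.
        v∶b⁻¹ : v ∶ b ⁻¹ ↦ b ⁻¹ ∙ z
        v∶b⁻¹ = ↦-resp b³t≈b⁻¹ (begin
          (b³ ∙ z) ∙ t      ≈⟨ assoc b³ z t ⟩
          b³ ∙ (z ∙ t)      ≈⟨ ∙-congˡ (↦-times m (↦-times 12 (sym b-z))) ⟩
          b³ ∙ (t ∙ z)      ≈⟨ assoc b³ t z ⟨
          (b³ ∙ t) ∙ z      ≈⟨ ∙-congʳ b³t≈b⁻¹ ⟩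
          b ⁻¹ ∙ z          ∎) (↦-∙ v∶b³ (↦-times m v-b¹²))
          where
          t : Carrier
          t = m times (12 times b)

          b³t≈b⁻¹ : b³ ∙ t ≈ b ⁻¹
          b³t≈b⁻¹ = inverseʳ-unique b _ (trans (solve 2 (λ b t → b ⊕ (((b ⊕ b) ⊕ b) ⊕ t)
            ⊜ (b ⊕ (b ⊕ (b ⊕ (b ⊕ id)))) ⊕ t) refl b t) b¹²ᵐ⁺⁴≈ε)

        v-b² : Commutes v b²
        v-b² = ↦-resp b⁻²⁻¹≈b² b⁻²⁻¹≈b² (↦-⁻¹ (↦-resp refl (begin
          (b ⁻¹ ∙ z) ∙ (b ⁻¹ ∙ z)    ≈⟨ ∙-interchange-comm (↦-flip b-z) ⟩
          b⁻² ∙ (z ∙ z)              ≈⟨ ∙-congˡ ω⁴≈ε ⟩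
          b⁻² ∙ ε                    ≈⟨ identityʳ b⁻² ⟩
          b⁻²                        ∎) (↦-∙ v∶b⁻¹ v∶b⁻¹)))
          where
          b⁻²⁻¹≈b² : b⁻² ⁻¹ ≈ b²
          b⁻²⁻¹≈b² = trans (⁻¹-cong b⁻²≈) (⁻¹-involutive b²)

        -- The innermost c(ab)c collapses to ab, which peels off one pair of factors c at a time.
        c^i[ab]c^i≈ab : ∀ i → (i times c ∙ (a ∙ b)) ∙ i times c ≈ a ∙ b
        c^i[ab]c^i≈ab zero    = trans (identityʳ _) (identityˡ _)
        c^i[ab]c^i≈ab (suc i) = begin
          ((c ∙ i times c) ∙ (a ∙ b)) ∙ (c ∙ i times c)    ≈⟨ ∙-congʳ (∙-congʳ (↦-times i refl)) ⟩
          ((i times c ∙ c) ∙ (a ∙ b)) ∙ (c ∙ i times c)    ≈⟨ solve 3 (λ x c y → ((x ⊕ c) ⊕ y) ⊕ (c ⊕ x)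
                                                               ⊜ (x ⊕ ((c ⊕ y) ⊕ c)) ⊕ x) refl (i times c) c (a ∙ b) ⟩
          (i times c ∙ ((c ∙ (a ∙ b)) ∙ c)) ∙ i times c    ≈⟨ ∙-congʳ (∙-congˡ cabc≈ab) ⟩
          (i times c ∙ (a ∙ b)) ∙ i times c                ≈⟨ c^i[ab]c^i≈ab i ⟩
          a ∙ b                                            ∎

        -- v is a power of c with v = v⁻¹, so v(ab)v = ab becomes commutation.
        v-ab : Commutes v (a ∙ b)
        v-ab = begin
          v ∙ (a ∙ b)                ≈⟨ //-rightDividesʳ v _ ⟨
          ((v ∙ (a ∙ b)) ∙ v) ∙ v ⁻¹ ≈⟨ ∙-cong (trans (∙-cong (∙-congʳ v-power) v-power) (c^i[ab]c^i≈ab n)) v⁻¹≈v ⟩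
          (a ∙ b) ∙ v                ∎

        -- In a = (ab)b⁻¹ the first factor is fixed by v and the second acquires z.
        v∶a : v ∶ a ↦ a ∙ z
        v∶a = ↦-resp (//-rightDividesʳ b a)
          (trans (sym (assoc _ _ z)) (∙-congʳ (//-rightDividesʳ b a))) (↦-∙ v-ab v∶b⁻¹)

        c-b⁸ : Commutes c b⁸
        c-b⁸ = ↦-resp refl (begin
          (e ∙ e) ∙ (e ∙ e)              ≈⟨ ∙-cong e²≈b⁴z e²≈b⁴z ⟩
          (b⁴ ∙ z) ∙ (b⁴ ∙ z)            ≈⟨ ∙-interchange-comm (↦-∘ b²-z b²-z) ⟩
          b⁸ ∙ (z ∙ z)                   ≈⟨ ∙-congˡ ω⁴≈ε ⟩
          b⁸ ∙ ε                         ≈⟨ identityʳ b⁸ ⟩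
          b⁸                             ∎) (↦-∙ (↦-∙ c∶b² c∶b²) (↦-∙ c∶b² c∶b²))
          where
          b²-z : Commutes b² z
          b²-z = ↦-∘ b-z b-z

          e²≈b⁴z : e ∙ e ≈ b⁴ ∙ z
          e²≈b⁴z = trans (∙-interchange-comm (sym (↦-∙ v-b² v-ω)))
            (trans (∙-cong (∙-interchange-comm b²-ω) v²≈ε) (identityʳ _))

      collapse-b : z ≈ ε
      collapse-b = collapse a∶b²↦b²ζ c∶b² (ζ↦ζ c-b⁸) v-b² v∶a

-- Modulo 12 the powers of 2 from 4 on alternate between 4 and 8; squaring makes the exponent even,
-- so the residue is 4 whatever the parity of j.
[2^[1+j]]²≡4+m*12 : ∀ j → ∃[ m ] 2 ℕ.^ suc j ℕ.* 2 ℕ.^ suc j ≡ 4 ℕ.+ m ℕ.* 12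
[2^[1+j]]²≡4+m*12 zero = 0 , ≡.refl
-- The new quotient comes from 4(4 + 12m) = 4 + 12(1 + 4m).
[2^[1+j]]²≡4+m*12 (suc j) with m , eq ← [2^[1+j]]²≡4+m*12 j = 1 ℕ.+ m ℕ.* 4 , (begin
  (2 ℕ.* x) ℕ.* (2 ℕ.* x)              ≡⟨ NS.solve 1 (λ x → (NS.con 2 NS.:* x) NS.:* (NS.con 2 NS.:* x)
                                            NS.:= NS.con 4 NS.:* (x NS.:* x)) ≡.refl x ⟩
  4 ℕ.* (x ℕ.* x)                      ≡⟨ ≡.cong (4 ℕ.*_) eq ⟩
  4 ℕ.* (4 ℕ.+ m ℕ.* 12)               ≡⟨ NS.solve 1 (λ m → NS.con 4 NS.:* (NS.con 4 NS.:+ m NS.:* NS.con 12)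
                                            NS.:= NS.con 4 NS.:+ (NS.con 1 NS.:+ m NS.:* NS.con 4) NS.:* NS.con 12) ≡.refl m ⟩
  4 ℕ.+ (1 ℕ.+ m ℕ.* 4) ℕ.* 12         ∎)
  where
  open ≡.≡-Reasoning
  x : ℕ
  x = 2 ℕ.^ suc j

-- From integer exponents to the abstract relations.

module _ {g ℓ} (G : Group g ℓ) where
  open Group G
  open Semiconjugation G
  open IntegerPower G

  -- Here β = 5 + n, so 2^(β-2) = 8 · 2ⁿ; the bound on β is what makes `w` and `z` powers of b⁸.
  module Exponents
    (n : ℕ) (ε₁ ε₂ : ℤ) (ε₁∈ : ε₁ ≡ 0ℤ ⊎ ε₁ ≡ 1ℤ) (ε₂∈ : ε₂ ≡ 1ℤ ⊎ ε₂ ≡ -1ℤ)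
    (a b c : Carrier)
    (b^2^β≈ε : (2 ℕ.^ (5 ℕ.+ n)) times b ≈ ε)
    ([ab]²≈ε : (a ∙ b) ∙ (a ∙ b) ≈ ε)
    ([bc]²≈ε : (b ∙ c) ∙ (b ∙ c) ≈ ε)
    ([abc]²≈ε : ((a ∙ b) ∙ c) ∙ ((a ∙ b) ∙ c) ≈ ε)
    (ba⁻¹ : b ∙ a ⁻¹ ≈ a ∙ b ^ᶻ (+ 3 ℤ.- ε₁ ℤ.* + (2 ℕ.^ (4 ℕ.+ n))))
    where

    open import Algebra.Properties.Group G
    open import Algebra.Solver.Monoid monoid using (solve; _⊕_; _⊜_; id)
    open import Relation.Binary.Reasoning.Setoid setoid

    private
      N₃ N₄ e₁ e₂ : ℤ
      N₃ = + (2 ℕ.^ (3 ℕ.+ n))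
      N₄ = + (2 ℕ.^ (4 ℕ.+ n))
      e₁ = ε₁ ℤ.* N₄
      e₂ = ε₂ ℤ.* N₃

      w z ζ ω : Carrier
      w = (2 ℕ.^ (3 ℕ.+ n)) times b
      z = (2 ℕ.^ (4 ℕ.+ n)) times b
      ζ = b ^ᶻ (ℤ.- e₁)
      ω = b ^ᶻ e₂

      double : ∀ x m → m times x ∙ m times x ≈ (2 ℕ.* m) times x
      double x m = trans (sym (×-homo-+ x m m)) (×-congˡ (≡.cong (m ℕ.+_) (≡.sym (ℕ.+-identityʳ m))))

      w²≈z : w ∙ w ≈ z
      w²≈z = double b (2 ℕ.^ (3 ℕ.+ n))

      z²≈ε : z ∙ z ≈ ε
      z²≈ε = trans (double b (2 ℕ.^ (4 ℕ.+ n))) b^2^β≈ε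

      z⁻¹≈z : z ⁻¹ ≈ z
      z⁻¹≈z = sym (inverseˡ-unique z z z²≈ε)

      8-power : ∀ m k → m ≡ k ℕ.* 8 → m times b ≈ k times (8 times b)
      8-power m k eq = trans (×-congˡ eq) (sym (×-assocˡ b k 8))

      w-power : w ≈ (2 ℕ.^ n) times (8 times b)
      w-power = 8-power _ (2 ℕ.^ n)
        (NS.solve 1 (λ x → NS.con 2 NS.:* (NS.con 2 NS.:* (NS.con 2 NS.:* x)) NS.:= x NS.:* NS.con 8) ≡.refl (2 ℕ.^ n))

      z-power : z ≈ (2 ℕ.* 2 ℕ.^ n) times (8 times b)
      z-power = 8-power _ (2 ℕ.* 2 ℕ.^ n)
        (NS.solve 1 (λ x → NS.con 2 NS.:* (NS.con 2 NS.:* (NS.con 2 NS.:* (NS.con 2 NS.:* x)))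
          NS.:= NS.con 2 NS.:* x NS.:* NS.con 8) ≡.refl (2 ℕ.^ n))

      ζ-spec′ : ∀ {e} → e ≡ 0ℤ ⊎ e ≡ 1ℤ → let ζ′ = b ^ᶻ (ℤ.- (e ℤ.* N₄)) in
        (∃[ l ] ζ′ ≈ l times (8 times b)) × ζ′ ∙ ζ′ ≈ ε
      ζ-spec′ (inj₁ ≡.refl) = (0 , refl) , identityˡ ε
      ζ-spec′ (inj₂ ≡.refl) = (2 ℕ.* 2 ℕ.^ n , trans ζ≈z z-power) , trans (∙-cong ζ≈z ζ≈z) z²≈ε
        where
        ζ≈z : b ^ᶻ (ℤ.- (1ℤ ℤ.* N₄)) ≈ z
        ζ≈z = begin
          b ^ᶻ (ℤ.- (1ℤ ℤ.* N₄))   ≡⟨ ≡.cong (λ i → b ^ᶻ (ℤ.- i)) (ℤ.*-identityˡ N₄) ⟩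
          b ^ᶻ (ℤ.- N₄)            ≈⟨ ^ᶻ-neg b N₄ ⟩
          z ⁻¹                                      ≈⟨ z⁻¹≈z ⟩
          z                                         ∎

      ζ-spec : (∃[ l ] ζ ≈ l times (8 times b)) × ζ ∙ ζ ≈ ε
      ζ-spec = ζ-spec′ ε₁∈

      ω-spec′ : ∀ {e} → e ≡ 1ℤ ⊎ e ≡ -1ℤ → let ω′ = b ^ᶻ (e ℤ.* N₃) in
        (∃[ k ] ω′ ≈ k times (8 times b)) × ω′ ∙ ω′ ≈ z
      ω-spec′ (inj₁ ≡.refl) = (2 ℕ.^ n , trans ω≈w w-power) , trans (∙-cong ω≈w ω≈w) w²≈z
        where
        ω≈w : b ^ᶻ (1ℤ ℤ.* N₃) ≈ w
        ω≈w = reflexive (≡.cong (b ^ᶻ_) (ℤ.*-identityˡ N₃))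
      -- A natural exponent is wanted for w⁻¹, and w⁴ = 1 provides w⁻¹ = w³.
      ω-spec′ (inj₂ ≡.refl) = (3 ℕ.* 2 ℕ.^ n , ω-power) , (begin
        ω′ ∙ ω′        ≈⟨ ∙-cong ω≈w⁻¹ ω≈w⁻¹ ⟩
        w ⁻¹ ∙ w ⁻¹    ≈⟨ ⁻¹-anti-homo-∙ w w ⟨
        (w ∙ w) ⁻¹     ≈⟨ ⁻¹-cong w²≈z ⟩
        z ⁻¹           ≈⟨ z⁻¹≈z ⟩
        z              ∎)
        where
        ω′ : Carrier
        ω′ = b ^ᶻ (-1ℤ ℤ.* N₃)

        ω≈w⁻¹ : ω′ ≈ w ⁻¹
        ω≈w⁻¹ = trans (reflexive (≡.cong (b ^ᶻ_) (ℤ.-1*i≡-i N₃))) (^ᶻ-neg b N₃)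

        ω-power : ω′ ≈ (3 ℕ.* 2 ℕ.^ n) times (8 times b)
        ω-power = begin
          ω′                                        ≈⟨ ω≈w⁻¹ ⟩
          w ⁻¹                                      ≈⟨ inverseˡ-unique (3 times w) w 3w∙w≈ε ⟨
          3 times w                                 ≈⟨ ×-congʳ 3 w-power ⟩
          3 times ((2 ℕ.^ n) times (8 times b))     ≈⟨ ×-assocˡ (8 times b) 3 (2 ℕ.^ n) ⟩
          (3 ℕ.* 2 ℕ.^ n) times (8 times b)         ∎
          where
          3w∙w≈ε : 3 times w ∙ w ≈ ε
          3w∙w≈ε = begin
            3 times w ∙ w        ≈⟨ solve 1 (λ w → (w ⊕ (w ⊕ (w ⊕ id))) ⊕ w ⊜ (w ⊕ w) ⊕ (w ⊕ w)) refl w ⟩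
            (w ∙ w) ∙ (w ∙ w)    ≈⟨ ∙-cong w²≈z w²≈z ⟩
            z ∙ z                ≈⟨ z²≈ε ⟩
            ε                    ∎

      ω-spec : (∃[ k ] ω ≈ k times (8 times b)) × ω ∙ ω ≈ z
      ω-spec = ω-spec′ ε₂∈

      ω⁴≈ε : (ω ∙ ω) ∙ (ω ∙ ω) ≈ ε
      ω⁴≈ε = trans (∙-cong (proj₂ ω-spec) (proj₂ ω-spec)) z²≈ε

      ba⁻¹′ : b ∙ a ⁻¹ ≈ a ∙ ((b ∙ (b ∙ b)) ∙ ζ)
      ba⁻¹′ = begin
        b ∙ a ⁻¹                    ≈⟨ ba⁻¹ ⟩
        a ∙ b ^ᶻ (+ 3 ℤ.- e₁)        ≈⟨ ∙-congˡ (^ᶻ-homo-+ b (+ 3) (ℤ.- e₁)) ⟩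
        a ∙ (3 times b ∙ ζ)         ≈⟨ ∙-congˡ (∙-congʳ (∙-congˡ (∙-congˡ (identityʳ b)))) ⟩
        a ∙ ((b ∙ (b ∙ b)) ∙ ζ)     ∎

      module C = Collapse G a b c ζ ω (proj₁ (proj₁ ζ-spec)) (proj₁ (proj₁ ω-spec))
        (proj₂ (proj₁ ζ-spec)) (proj₂ ζ-spec) (proj₂ (proj₁ ω-spec)) ω⁴≈ε
        [ab]²≈ε [bc]²≈ε [abc]²≈ε ba⁻¹′

    b^2^[β-1]≈ε-a : 8 times c ≈ ε →
      b ∙ c ^ᶻ (+ 2) ≈ c ^ᶻ (+ 2) ∙ b ^ᶻ (+ 1 ℤ.+ ε₂ ℤ.* + (2 ℕ.^ (3 ℕ.+ n))) →
      (2 ℕ.^ (4 ℕ.+ n)) times b ≈ ε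
    b^2^[β-1]≈ε-a c⁸≈ε bc² = trans (sym (proj₂ ω-spec)) (C.collapse-a
      (trans (solve 1 (λ x → ((x ⊕ x) ⊕ (x ⊕ x)) ⊕ ((x ⊕ x) ⊕ (x ⊕ x))
        ⊜ x ⊕ (x ⊕ (x ⊕ (x ⊕ (x ⊕ (x ⊕ (x ⊕ (x ⊕ id)))))))) refl c) c⁸≈ε)
      (begin
        b ∙ (c ∙ c)                                 ≈⟨ ∙-congˡ 2c≈ ⟨
        b ∙ c ^ᶻ (+ 2)                              ≈⟨ bc² ⟩
        c ^ᶻ (+ 2) ∙ b ^ᶻ (+ 1 ℤ.+ e₂)               ≈⟨ ∙-cong 2c≈ (trans (^ᶻ-homo-+ b (+ 1) e₂) (∙-congʳ (identityʳ b))) ⟩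
        (c ∙ c) ∙ (b ∙ ω)                           ∎))
      where
      2c≈ : 2 times c ≈ c ∙ c
      2c≈ = ∙-congˡ (identityʳ c)

    b^2^[β-1]≈ε-b : (2 ℕ.^ (4 ℕ.+ n)) times c ≈ ε →
      c ⁻¹ ∙ b ≈ b ^ᶻ (+ 3 ℤ.+ ε₂ ℤ.* + (2 ℕ.^ (3 ℕ.+ n))) ∙ c ^ᶻ (+ 1 ℤ.- + (2 ℕ.^ (3 ℕ.+ n))) →
      c ∙ b ⁻¹ ≈ b ^ᶻ (ℤ.- (+ 3) ℤ.+ ε₂ ℤ.* + (2 ℕ.^ (3 ℕ.+ n))) ∙ c ^ᶻ (ℤ.- (+ 1) ℤ.+ + (2 ℕ.^ (3 ℕ.+ n))) →
      (2 ℕ.^ (4 ℕ.+ n)) times b ≈ ε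
    b^2^[β-1]≈ε-b c^r≈ε c⁻¹b cb⁻¹ = trans (sym (proj₂ ω-spec)) (C.collapse-b v (2 ℕ.^ (3 ℕ.+ n)) (proj₁ m-spec) refl v²≈ε
      b¹²ᵐ⁺⁴≈ε
      (trans c⁻¹b (∙-cong
        (trans (^ᶻ-homo-+ b (+ 3) e₂) (∙-congʳ 3b≈))
        (trans (^ᶻ-homo-+ c (+ 1) (ℤ.- N₃)) (∙-cong (identityʳ c) (trans (^ᶻ-neg c N₃) v⁻¹≈v)))))
      (trans cb⁻¹ (∙-cong
        (trans (^ᶻ-homo-+ b -[1+ 2 ] e₂) (∙-congʳ (⁻¹-cong 3b≈)))
        (trans (^ᶻ-homo-+ c -[1+ 0 ] N₃) (∙-congʳ (⁻¹-cong (identityʳ c)))))))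
      where
      v : Carrier
      v = (2 ℕ.^ (3 ℕ.+ n)) times c

      v²≈ε : v ∙ v ≈ ε
      v²≈ε = trans (double c (2 ℕ.^ (3 ℕ.+ n))) c^r≈ε

      v⁻¹≈v : v ⁻¹ ≈ v
      v⁻¹≈v = sym (inverseˡ-unique v v v²≈ε)

      3b≈ : 3 times b ≈ b ∙ b ∙ b
      3b≈ = solve 1 (λ b → b ⊕ (b ⊕ (b ⊕ id)) ⊜ (b ⊕ b) ⊕ b) refl b

      q : ℕ
      q = 2 ℕ.^ (5 ℕ.+ n)

      m-spec : ∃[ m ] q ℕ.* q ≡ 4 ℕ.+ m ℕ.* 12
      m-spec = [2^[1+j]]²≡4+m*12 (4 ℕ.+ n)

      times-ε : ∀ i → i times ε ≈ ε
      times-ε zero    = refl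
      times-ε (suc i) = trans (identityˡ _) (times-ε i)

      -- The exponent q² is used in place of q = 2^β because q² always leaves remainder 4 modulo 12.
      b¹²ᵐ⁺⁴≈ε : 4 times b ∙ proj₁ m-spec times (12 times b) ≈ ε
      b¹²ᵐ⁺⁴≈ε = begin
        4 times b ∙ proj₁ m-spec times (12 times b)    ≈⟨ ∙-congˡ (×-assocˡ b (proj₁ m-spec) 12) ⟩
        4 times b ∙ (proj₁ m-spec ℕ.* 12) times b      ≈⟨ ×-homo-+ b 4 (proj₁ m-spec ℕ.* 12) ⟨
        (4 ℕ.+ proj₁ m-spec ℕ.* 12) times b            ≈⟨ ×-congˡ (proj₂ m-spec) ⟨
        (q ℕ.* q) times b                              ≈⟨ ×-assocˡ b q q ⟨
        q times (q times b)                            ≈⟨ ×-congʳ q b^2^β≈ε ⟩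
        q times ε                                      ≈⟨ times-ε q ⟩
        ε                                              ∎

open ≡ using (refl; sym; trans; cong; cong₂; subst; subst₂)

-- Lists by position and strictly increasing sequences.

module _ {A : Set} where

  -- Positions beyond the end of the list return the default.
  nth : A → List A → ℕ → A
  nth d []       i       = d
  nth d (x ∷ xs) zero    = x
  nth d (x ∷ xs) (suc i) = nth d xs i

  nth-∈ : ∀ d xs {i} → i ℕ.< length xs → nth d xs i ∈ xs
  nth-∈ d (x ∷ xs) {zero}  i< = here refl
  nth-∈ d (x ∷ xs) {suc i} i< = there (nth-∈ d xs (s<s⁻¹ i<))

  ∈⇒nth : ∀ d {x xs} → x ∈ xs → ∃[ i ] i ℕ.< length xs × x ≡ nth d xs i
  ∈⇒nth d (here refl) = 0 , z<s , refl
  ∈⇒nth d (there x∈) with i , i< , eq ← ∈⇒nth d x∈ = suc i , s<s i< , eq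

  nth-allPairs : ∀ d {R : A → A → Set} {xs} → AllPairs R xs →
    ∀ {i j} → i ℕ.< j → j ℕ.< length xs → R (nth d xs i) (nth d xs j)
  nth-allPairs d {xs = x ∷ xs} (Rx ∷ Rxs) {zero}  {suc j} i<j j< = All.lookup Rx (nth-∈ d xs (s<s⁻¹ j<))
  nth-allPairs d {xs = x ∷ xs} (Rx ∷ Rxs) {suc i} {suc j} i<j j< = nth-allPairs d Rxs (s<s⁻¹ i<j) (s<s⁻¹ j<)

  nth-ext : ∀ d xs ys → length xs ≡ length ys →
    (∀ i → i ℕ.< length xs → nth d xs i ≡ nth d ys i) → xs ≡ ys
  nth-ext d []       []       len eq = refl
  nth-ext d (x ∷ xs) (y ∷ ys) len eq =
    cong₂ _∷_ (eq 0 z<s) (nth-ext d xs ys (ℕ.suc-injective len) (λ i i< → eq (suc i) (s<s i<)))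

  nth-map : ∀ d (f : A → A) xs {i} → i ℕ.< length xs → nth d (map f xs) i ≡ f (nth d xs i)
  nth-map d f (x ∷ xs) {zero}  i< = refl
  nth-map d f (x ∷ xs) {suc i} i< = nth-map d f xs (s<s⁻¹ i<)

  nth-applyUpTo : ∀ d f m {i} → i ℕ.< m → nth d (applyUpTo f m) i ≡ f i
  nth-applyUpTo d f (suc m) {zero}  i< = refl
  nth-applyUpTo d f (suc m) {suc i} i< = nth-applyUpTo d (f ∘ suc) m (s<s⁻¹ i<)

↔-injective : ∀ {A B : Set} (I : A ↔ B) {x y} → Inverse.to I x ≡ Inverse.to I y → x ≡ y
↔-injective I {x} {y} eq =
  trans (sym (Inverse.strictlyInverseʳ I x)) (trans (cong (Inverse.from I) eq) (Inverse.strictlyInverseʳ I y))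

-- Each step gains at least one, which bounds `g i` below from the start and above from the end.
-- Applied to heights along a flag, it shows that position and height agree.
<-mono⇒≡ : ∀ (g : ℕ → ℕ) N → (∀ i → i ℕ.< N → g i ℕ.< g (suc i)) → g N ℕ.≤ N → ∀ {i} → i ℕ.≤ N → g i ≡ i
<-mono⇒≡ g N mono gN≤N {i} i≤N = ℕ.≤-antisym upper lower
  where
  open ℕ.≤-Reasoning
  grow : ∀ k i → i ℕ.+ k ℕ.≤ N → g i ℕ.+ k ℕ.≤ g (i ℕ.+ k)
  grow zero    i le = begin
    g i ℕ.+ 0    ≡⟨ ℕ.+-identityʳ (g i) ⟩
    g i        ≡⟨ cong g (ℕ.+-identityʳ i) ⟨
    g (i ℕ.+ 0)  ∎
  grow (suc k) i le = begin
    g i ℕ.+ suc k      ≡⟨ ℕ.+-suc (g i) k ⟩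
    suc (g i ℕ.+ k)    ≤⟨ s≤s (grow k i (ℕ.≤-trans (ℕ.n≤1+n _) le′)) ⟩
    suc (g (i ℕ.+ k))  ≤⟨ mono (i ℕ.+ k) le′ ⟩
    g (suc (i ℕ.+ k))  ≡⟨ cong g (ℕ.+-suc i k) ⟨
    g (i ℕ.+ suc k)    ∎
    where
    le′ : suc (i ℕ.+ k) ℕ.≤ N
    le′ = subst (ℕ._≤ N) (ℕ.+-suc i k) le

  lower : i ℕ.≤ g i
  lower = ℕ.≤-trans (ℕ.m≤n+m i (g 0)) (grow i 0 i≤N)

  upper : g i ℕ.≤ i
  upper = ℕ.+-cancelʳ-≤ (N ∸ i) (g i) i (begin
    g i ℕ.+ (N ∸ i)    ≤⟨ grow (N ∸ i) i (ℕ.≤-reflexive (ℕ.m+[n∸m]≡n i≤N)) ⟩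
    g (i ℕ.+ (N ∸ i))  ≡⟨ cong g (ℕ.m+[n∸m]≡n i≤N) ⟩
    g N              ≤⟨ gN≤N ⟩
    N                ≡⟨ ℕ.m+[n∸m]≡n i≤N ⟨
    i ℕ.+ (N ∸ i)      ∎)

-- Flags indexed by height, adjacency and the action of automorphisms.

module Flags {n : ℕ} (P : Polytope n) where
  open import Data.Nat.Base using (_+_)
  open Polytope P
  open Flag

  Flagₚ : Set
  Flagₚ = Flag rankedPoset

  private variable
    Φ Ψ X Y : Flagₚ
    F G H K L : Face
    i j k h : ℕ

  infix 4 _~[_]_
  infixl 7 _◂_

  _~[_]_ : Flagₚ → ℕ → Flagₚ → Set
  Φ ~[ j ] Ψ = Adjacent rankedPoset j Φ Ψ

  _◂_ : Flagₚ → Automorphism P → Flagₚ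
  _◂_ = _·_ P

  _<?_ : ∀ F G → Dec (F < G)
  F <? G = (F ≤? G) ×-dec ¬? (F ≟ G)

  -- The irrelevant proof inside a flag becomes usable because the order is decidable.
  faces-chain : (Φ : Flagₚ) → AllPairs _<_ (faces Φ)
  faces-chain (mkFlag Fs Fs-chain _) = recompute (allPairs? _<?_ Fs) Fs-chain

  at : Flagₚ → ℕ → Face
  -- The least face is only a default; it is never reached at heights below 2 + n.
  at Φ = nth (proj₁ least) (faces Φ)

  private
    ⊢length : ∀ Φ → h ℕ.< 2 + n → h ℕ.< length (faces Φ)
    ⊢length Φ = subst (_ ℕ.<_) (sym (flag-length Φ))

  at-< : ∀ Φ → i ℕ.< j → j ℕ.< 2 + n → at Φ i < at Φ j
  at-< Φ i<j j< = nth-allPairs _ {xs = faces Φ} (faces-chain Φ) i<j (⊢length Φ j<)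

  at-≤ : ∀ Φ → suc i ℕ.< 2 + n → at Φ i ≤ at Φ (suc i)
  at-≤ Φ i< = proj₁ (at-< Φ (ℕ.n<1+n _) i<)

  height-at : ∀ Φ → h ℕ.< 2 + n → height (at Φ h) ≡ h
  height-at Φ h< = <-mono⇒≡ (height ∘ at Φ) (suc n)
    (λ i i< → height-mono (at-< Φ (ℕ.n<1+n i) (s<s i<))) (height-bound _) (ℕ.≤-pred h<)

  at-∈ : ∀ Φ → h ℕ.< 2 + n → at Φ h ∈ faces Φ
  at-∈ Φ h< = nth-∈ _ (faces Φ) (⊢length Φ h<)

  ∈⇒at : ∀ Φ → F ∈ faces Φ → F ≡ at Φ (height F)
  ∈⇒at {F} Φ F∈ with i , i< , refl ← ∈⇒nth (proj₁ least) F∈ =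
    cong (at Φ) (sym (height-at Φ (subst (i ℕ.<_) (flag-length Φ) i<)))

  ∈-at : ∀ Φ → F ∈ faces Φ → height F ≡ h → F ≡ at Φ h
  ∈-at Φ F∈ refl = ∈⇒at Φ F∈

  faces-injective : faces Φ ≡ faces Ψ → Φ ≡ Ψ
  faces-injective refl = refl

  flag-ext : (∀ h → h ℕ.< 2 + n → at Φ h ≡ at Ψ h) → Φ ≡ Ψ
  flag-ext {Φ} {Ψ} eq = faces-injective (nth-ext _ _ _ (trans (flag-length Φ) (sym (flag-length Ψ)))
    (λ i i< → eq i (subst (i ℕ.<_) (flag-length Φ) i<)))

  ≤-height⇒≡ : F ≤ G → height F ≡ height G → F ≡ G
  ≤-height⇒≡ {F} {G} F≤G eq with F ≟ G
  ... | yes F≡G = F≡G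
  ... | no  F≢G = contradiction eq (ℕ.<⇒≢ (height-mono (F≤G , F≢G)))

  module FromFaces (f : ℕ → Face) (height-f : ∀ h → h ℕ.< 2 + n → height (f h) ≡ h)
    (step : ∀ h → suc h ℕ.< 2 + n → f h ≤ f (suc h)) where

    private
      f-mono : ∀ {i j} → i ℕ.≤′ j → j ℕ.< 2 + n → f i ≤ f j
      f-mono ℕ.≤′-refl       j< = ≤-refl
      f-mono (ℕ.≤′-step i≤j) j< = ≤-trans (f-mono i≤j (ℕ.<-trans (ℕ.n<1+n _) j<)) (step _ j<)

      strict : ∀ {i j} → i ℕ.< j → j ℕ.< 2 + n → f i < f j
      strict {i} {j} i<j j< = f-mono (ℕ.≤⇒≤′ (ℕ.<⇒≤ i<j)) j< , λ eq → ℕ.<⇒≢ i<j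
        (trans (sym (height-f i (ℕ.<-trans i<j j<))) (trans (cong height eq) (height-f j j<)))

      -- A face incident to all listed ones is comparable with the listed face of its own height,
      -- hence equal to it.
      maximal′ : ∀ F → F ∉ applyUpTo f (2 + n) → ¬ All (Incident rankedPoset F) (applyUpTo f (2 + n))
      maximal′ F F∉ inc = F∉ (subst (_∈ applyUpTo f (2 + n)) (sym F≡) f∈)
        where
        h< : height F ℕ.< 2 + n
        h< = s<s (height-bound F)
        f∈ : f (height F) ∈ applyUpTo f (2 + n)
        f∈ = ∈-applyUpTo⁺ f h<
        F≡ : F ≡ f (height F)
        F≡ with All.lookup inc f∈
        ... | inj₁ F≤ = ≤-height⇒≡ F≤ (sym (height-f _ h<))
        ... | inj₂ F≥ = sym (≤-height⇒≡ F≥ (height-f _ h<))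

    flag : Flagₚ
    flag = mkFlag (applyUpTo f (2 + n)) (AllPairs.applyUpTo⁺₁ f (2 + n) strict) maximal′

    at-flag : h ℕ.< 2 + n → at flag h ≡ f h
    at-flag = nth-applyUpTo _ f (2 + n)

  -- This is `SectionFace` one level above `F` with relevant proofs, which decidability recovers.
  record Between (F H G : Face) : Set where
    constructor between
    field
      lower  : F ≤ H
      upper  : H ≤ G
      level  : height H ≡ 1 + height F

  private
    toSection : Between F H G → SectionFace rankedPoset F G (1 + height F)
    toSection (between l u e) = mkSectionFace _ l u e

    fromSection : (S : SectionFace rankedPoset F G (1 + height F)) → Between F (SectionFace.face S) G
    fromSection {F} {G} (mkSectionFace H l u e) =
      between (recompute (F ≤? H) l) (recompute (H ≤? G) u) (recompute (height H ℕ.≟ _) e)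

    Fin2-other : (i : Fin 2) → ∃[ j ] j ≢ i
    Fin2-other Fin.zero           = Fin.suc Fin.zero , λ ()
    Fin2-other (Fin.suc Fin.zero) = Fin.zero , λ ()

    Fin2-unique : {i j k : Fin 2} → j ≢ i → k ≢ i → j ≡ k
    Fin2-unique {Fin.zero}         {Fin.zero}         j≢ k≢ = contradiction refl j≢
    Fin2-unique {Fin.zero}         {Fin.suc Fin.zero} {Fin.zero} j≢ k≢ = contradiction refl k≢
    Fin2-unique {Fin.zero}         {Fin.suc Fin.zero} {Fin.suc Fin.zero} j≢ k≢ = refl
    Fin2-unique {Fin.suc Fin.zero} {Fin.zero} {Fin.zero} j≢ k≢ = refl
    Fin2-unique {Fin.suc Fin.zero} {Fin.zero} {Fin.suc Fin.zero} j≢ k≢ = contradiction refl k≢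
    Fin2-unique {Fin.suc Fin.zero} {Fin.suc Fin.zero} j≢ k≢ = contradiction refl j≢

  section-≡ : {S T : SectionFace rankedPoset F G h} → SectionFace.face S ≡ SectionFace.face T → S ≡ T
  section-≡ refl = refl

  section-face : F ≤ G → height G ≡ 2 + height F → ∃[ H ] Between F H G
  section-face F≤G eq = _ , fromSection (Inverse.from (diamond _ _ F≤G eq) Fin.zero)

  section-other : height G ≡ 2 + height F → Between F H G → ∃[ K ] Between F K G × K ≢ H
  section-other {G} {F} {H} eq b = face S , fromSection S ,
    λ K≡H → proj₂ other (trans (sym (I.strictlyInverseˡ _)) (cong I.to (section-≡ K≡H)))
    where
    open SectionFace
    module I = Inverse (diamond F G (≤-trans (Between.lower b) (Between.upper b)) eq)
    other : ∃[ j ] j ≢ I.to (toSection b)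
    other = Fin2-other _
    S : SectionFace rankedPoset F G (1 + height F)
    S = I.from (proj₁ other)

  section-unique : height G ≡ 2 + height F → Between F H G → Between F K G → Between F L G →
    K ≢ H → L ≢ H → K ≡ L
  section-unique {G} {F} {H} eq bH bK bL K≢H L≢H =
    cong SectionFace.face (↔-injective I (Fin2-unique (separate bK K≢H) (separate bL L≢H)))
    where
    I : SectionFace rankedPoset F G (1 + height F) ↔ Fin 2
    I = diamond F G (≤-trans (Between.lower bH) (Between.upper bH)) eq
    separate : ∀ {K} (bK : Between F K G) → K ≢ H → Inverse.to I (toSection bK) ≢ Inverse.to I (toSection bH)
    separate bK K≢H p = K≢H (cong SectionFace.face (↔-injective I p))

  height-at-suc² : ∀ Φ → j ℕ.< n → height (at Φ (2 + j)) ≡ 2 + height (at Φ j)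
  height-at-suc² Φ j<n = trans (height-at Φ (s<s (s<s j<n)))
    (cong (suc ∘ suc) (sym (height-at Φ (ℕ.<-trans j<n (ℕ.m<n+m n z<s)))))

  at-between : ∀ Φ → j ℕ.< n → Between (at Φ j) (at Φ (1 + j)) (at Φ (2 + j))
  at-between {j} Φ j<n = between (at-≤ Φ 1+j<) (at-≤ Φ (s<s (s<s j<n)))
    (trans (height-at Φ 1+j<) (cong suc (sym (height-at Φ (ℕ.<-trans (ℕ.n<1+n j) 1+j<)))))
    where
    1+j< : 1 + j ℕ.< 2 + n
    1+j< = s<s (ℕ.<-trans j<n (ℕ.n<1+n n))

  ~-at : Φ ~[ j ] Ψ → h ℕ.< 2 + n → h ≢ suc j → at Φ h ≡ at Ψ h
  ~-at {Φ} {j} {Ψ} {h} (_ , same) h< h≢ = ∈-at Ψ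
    (Equivalence.to (same (at Φ h) (h≢ ∘ trans (sym (height-at Φ h<)))) (at-∈ Φ h<)) (height-at Φ h<)

  at⇒~ : Φ ≢ Ψ → (∀ h → h ℕ.< 2 + n → h ≢ suc j → at Φ h ≡ at Ψ h) → Φ ~[ j ] Ψ
  at⇒~ {Φ} {Ψ} {j} Φ≢Ψ eq = Φ≢Ψ , λ F F≢ → mk⇔
    (λ F∈ → subst (_∈ faces Ψ) (sym (trans (∈⇒at Φ F∈) (eq _ (s<s (height-bound F)) F≢))) (at-∈ Ψ (s<s (height-bound F))))
    (λ F∈ → subst (_∈ faces Φ) (sym (trans (∈⇒at Ψ F∈) (sym (eq _ (s<s (height-bound F)) F≢)))) (at-∈ Φ (s<s (height-bound F))))

  ~-sym : Φ ~[ j ] Ψ → Ψ ~[ j ] Φ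
  ~-sym p@(Φ≢Ψ , _) = at⇒~ (Φ≢Ψ ∘ sym) (λ h h< h≢ → sym (~-at p h< h≢))

  ~⇒at≢ : Φ ~[ j ] Ψ → at Φ (suc j) ≢ at Ψ (suc j)
  ~⇒at≢ {Φ} {j} {Ψ} p eq = proj₁ p (flag-ext same)
    where
    same : ∀ h → h ℕ.< 2 + n → at Φ h ≡ at Ψ h
    same h h< with h ℕ.≟ suc j
    ... | yes refl = eq
    ... | no  h≢   = ~-at p h< h≢

  at-top : ∀ Φ → at Φ (suc n) ≡ proj₁ greatest
  at-top Φ = ≤-height⇒≡ (proj₂ greatest _) (ℕ.≤-antisym
    (mono≤ (proj₂ greatest _))
    (subst (height _ ℕ.≤_) (sym (height-at Φ ℕ.≤-refl)) (height-bound _)))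
    where
    mono≤ : F ≤ G → height F ℕ.≤ height G
    mono≤ {F} {G} F≤G with F ≟ G
    ... | yes refl = ℕ.≤-refl
    ... | no  F≢G  = ℕ.<⇒≤ (height-mono (F≤G , F≢G))

  -- The greatest face cannot be exchanged, and there are no heights beyond it.
  ~⇒< : Φ ~[ j ] Ψ → j ℕ.< n
  ~⇒< {Φ} {j} {Ψ} p with ℕ.<-cmp j n
  ... | tri< j<n _ _ = j<n
  ... | tri≈ _ refl _ = contradiction (trans (at-top Φ) (sym (at-top Ψ))) (~⇒at≢ p)
  ... | tri> _ _ n<j = contradiction
    (flag-ext (λ h h< → ~-at p h< (ℕ.<⇒≢ (ℕ.<-≤-trans h< (s≤s n<j))))) (proj₁ p)

  -- Both flags replace the same face between the same neighbours, and the diamond condition leaves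
  -- only one alternative.
  ~-unique : Φ ~[ j ] Ψ → Φ ~[ j ] X → Ψ ≡ X
  ~-unique {Φ} {j} {Ψ} {X} p q = flag-ext same
    where
    j<n : j ℕ.< n
    j<n = ~⇒< p

    transport : Φ ~[ j ] Y → Between (at Φ j) (at Y (1 + j)) (at Φ (2 + j))
    transport {Y} r = subst₂ (λ F G → Between F (at Y (1 + j)) G)
      (sym (~-at r (ℕ.<-trans j<n (ℕ.m<n+m n z<s)) (ℕ.<⇒≢ (ℕ.n<1+n j))))
      (sym (~-at r (s<s (s<s j<n)) (ℕ.<⇒≢ (ℕ.n<1+n (suc j)) ∘ sym)))
      (at-between Y j<n)

    same : ∀ h → h ℕ.< 2 + n → at Ψ h ≡ at X h
    same h h< with h ℕ.≟ suc j
    ... | no  h≢   = trans (sym (~-at p h< h≢)) (~-at q h< h≢)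
    ... | yes refl = section-unique (height-at-suc² Φ j<n) (at-between Φ j<n) (transport p) (transport q)
      (~⇒at≢ p ∘ sym) (~⇒at≢ q ∘ sym)

  at-◂ : ∀ Φ σ → h ℕ.< 2 + n → at (Φ ◂ σ) h ≡ Automorphism.to σ (at Φ h)
  at-◂ Φ σ h< = nth-map _ (Automorphism.to σ) (faces Φ) (⊢length Φ h<)

  ◂-injective : ∀ σ → Φ ◂ σ ≡ Ψ ◂ σ → Φ ≡ Ψ
  ◂-injective {Φ} {Ψ} σ eq = flag-ext (λ h h< → ↔-injective (Automorphism.bijection σ)
    (trans (sym (at-◂ Φ σ h<)) (trans (cong (λ X → at X h) eq) (at-◂ Ψ σ h<))))

  ~-◂ : ∀ σ → Φ ~[ j ] Ψ → Φ ◂ σ ~[ j ] Ψ ◂ σ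
  ~-◂ {Φ} {j} {Ψ} σ p = at⇒~ (proj₁ p ∘ ◂-injective σ) (λ h h< h≢ →
    trans (at-◂ Φ σ h<) (trans (cong (Automorphism.to σ) (~-at p h< h≢)) (sym (at-◂ Ψ σ h<))))

  module _ {j : ℕ} (j<n : j ℕ.< n) (Φ : Flagₚ) where

    private
      other : ∃[ K ] Between (at Φ j) K (at Φ (2 + j)) × K ≢ at Φ (1 + j)
      other = section-other (height-at-suc² Φ j<n) (at-between Φ j<n)

      open Between (proj₁ (proj₂ other))

      1+j< : 1 + j ℕ.< 2 + n
      1+j< = s<s (ℕ.<-trans j<n (ℕ.n<1+n n))

      f : ℕ → Face
      f h with h ℕ.≟ suc j
      ... | yes _ = proj₁ other
      ... | no  _ = at Φ h

      height-f : ∀ h → h ℕ.< 2 + n → height (f h) ≡ h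
      height-f h h< with h ℕ.≟ suc j
      ... | yes refl = trans level (cong suc (height-at Φ (ℕ.<-trans (ℕ.n<1+n j) h<)))
      ... | no  _    = height-at Φ h<

      step : ∀ h → suc h ℕ.< 2 + n → f h ≤ f (suc h)
      step h h< with h ℕ.≟ suc j | suc h ℕ.≟ suc j
      ... | yes refl | yes ()
      ... | yes refl | no  _    = upper
      ... | no  _    | yes refl = lower
      ... | no  _    | no  _    = at-≤ Φ h<

      open FromFaces f height-f step

      f-away : h ≢ suc j → f h ≡ at Φ h
      f-away {h} h≢ with h ℕ.≟ suc j
      ... | yes h≡ = contradiction h≡ h≢
      ... | no  _  = refl

      f-suc : f (suc j) ≡ proj₁ other
      f-suc with suc j ℕ.≟ suc j
      ... | yes _  = refl
      ... | no  j≢ = contradiction refl j≢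

    -- Later arguments use only `~-adj` and uniqueness, so the construction need not unfold.
    abstract
      adj : Flagₚ
      adj = flag

      ~-adj : Φ ~[ j ] adj
      ~-adj = at⇒~ Φ≢adj (λ h h< h≢ → sym (trans (at-flag h<) (f-away h≢)))
        where
        Φ≢adj : Φ ≢ adj
        Φ≢adj Φ≡ = proj₂ (proj₂ other) (trans (sym f-suc) (trans (sym (at-flag 1+j<))
          (sym (cong (λ X → at X (suc j)) Φ≡))))

  ~⇒adj : (j<n : j ℕ.< n) → Φ ~[ j ] Ψ → Ψ ≡ adj j<n Φ
  ~⇒adj j<n p = ~-unique p (~-adj j<n _)

  adj-at : (j<n : j ℕ.< n) → h ℕ.< 2 + n → h ≢ suc j → at (adj j<n Φ) h ≡ at Φ h
  adj-at j<n h< h≢ = sym (~-at (~-adj j<n _) h< h≢)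

  adj-involutive : (j<n : j ℕ.< n) → adj j<n (adj j<n Φ) ≡ Φ
  adj-involutive j<n = sym (~⇒adj j<n (~-sym (~-adj j<n _)))

  adj-◂ : (j<n : j ℕ.< n) → ∀ σ → adj j<n Φ ◂ σ ≡ adj j<n (Φ ◂ σ)
  adj-◂ j<n σ = ~⇒adj j<n (~-◂ σ (~-adj j<n _))

  -- The exchanged face is determined by the old one and its two neighbours in the flag.
  adj-local : (i<n : i ℕ.< n) → (∀ h → i ℕ.≤ h → h ℕ.≤ 2 + i → at Φ h ≡ at Ψ h) →
    at (adj i<n Φ) (suc i) ≡ at (adj i<n Ψ) (suc i)
  adj-local {i} {Φ} {Ψ} i<n eq = section-unique (height-at-suc² Φ i<n) (at-between Φ i<n)
    (bet Φ refl refl) (bet Ψ (eq i ℕ.≤-refl (ℕ.m≤n+m i 2)) (eq (2 + i) (ℕ.m≤n+m i 2) ℕ.≤-refl))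
    (λ p → ~⇒at≢ (~-adj i<n Φ) (sym p))
    (λ p → ~⇒at≢ (~-adj i<n Ψ) (trans (sym (eq (1 + i) (ℕ.n≤1+n i) (ℕ.n≤1+n _))) (sym p)))
    where
    bet : ∀ X → at Φ i ≡ at X i → at Φ (2 + i) ≡ at X (2 + i) →
      Between (at Φ i) (at (adj i<n X) (1 + i)) (at Φ (2 + i))
    bet X p q = subst₂ (λ F G → Between F (at (adj i<n X) (1 + i)) G)
      (trans (adj-at i<n (ℕ.<-trans i<n (ℕ.m<n+m n z<s)) (ℕ.<⇒≢ (ℕ.n<1+n i))) (sym p))
      (trans (adj-at i<n (s<s (s<s i<n)) (ℕ.<⇒≢ (ℕ.n<1+n (suc i)) ∘ sym)) (sym q))
      (at-between (adj i<n X) i<n)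

  -- Each exchange leaves untouched the three heights that determine the other, since the indices
  -- differ by at least 2.
  adj-comm : (i<n : i ℕ.< n) (j<n : j ℕ.< n) → 2 + i ℕ.≤ j → adj i<n (adj j<n Φ) ≡ adj j<n (adj i<n Φ)
  adj-comm {i} {j} {Φ} i<n j<n 2+i≤j = flag-ext same
    where
    same : ∀ h → h ℕ.< 2 + n → at (adj i<n (adj j<n Φ)) h ≡ at (adj j<n (adj i<n Φ)) h
    same h h< with h ℕ.≟ suc i | h ℕ.≟ suc j
    ... | yes refl | yes refl = contradiction 2+i≤j (ℕ.<⇒≱ (ℕ.m<n+m i z<s))
    ... | yes refl | no  h≢   = trans
      (adj-local i<n (λ h _ h≤ → adj-at j<n (ℕ.≤-<-trans h≤ (s<s (s<s i<n))) (ℕ.<⇒≢ (ℕ.≤-<-trans (ℕ.≤-trans h≤ 2+i≤j) (ℕ.n<1+n j)))))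
      (sym (adj-at j<n h< h≢))
    ... | no  h≢   | yes refl = trans (adj-at i<n h< h≢)
      (sym (adj-local j<n (λ h h≥ h≤ → adj-at i<n (ℕ.≤-<-trans h≤ (s<s (s<s j<n))) (ℕ.<⇒≢ (ℕ.≤-trans 2+i≤j h≥) ∘ sym))))
    ... | no  h≢i  | no  h≢j  = trans (adj-at i<n h< h≢i) (trans (adj-at j<n h< h≢j)
      (sym (trans (adj-at j<n h< h≢j) (adj-at i<n h< h≢i))))

  private
    module A = Group (automorphismGroup P)

  ◂-∙ : ∀ Φ σ τ → Φ ◂ (σ A.∙ τ) ≡ (Φ ◂ σ) ◂ τ
  ◂-∙ Φ σ τ = faces-injective (map-∘ (faces Φ))

  ◂-ε : ∀ Φ → Φ ◂ A.ε ≡ Φ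
  ◂-ε Φ = faces-injective (map-id (faces Φ))

  ◂-cong : ∀ Φ σ τ → σ A.≈ τ → Φ ◂ σ ≡ Φ ◂ τ
  ◂-cong Φ σ τ σ≈τ = faces-injective (map-cong σ≈τ (faces Φ))

  -- Identifying automorphisms that agree on flags spares the proof that every face
  -- lies on a flag.
  flagGroup : Group 0ℓ 0ℓ
  flagGroup = record
    { Carrier = Automorphism P
    ; _≈_     = λ σ τ → ∀ Φ → Φ ◂ σ ≡ Φ ◂ τ
    ; _∙_     = A._∙_
    ; ε       = A.ε
    ; _⁻¹     = A._⁻¹
    ; isGroup = record
      { isMonoid = record
        { isSemigroup = record
          { isMagma = record
            { isEquivalence = record
              { refl  = λ _ → refl
              ; sym   = λ p Φ → sym (p Φ)
              ; trans = λ p q Φ → trans (p Φ) (q Φ)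
              }
            ; ∙-cong = λ {σ} {σ′} {τ} {τ′} p q Φ →
                trans (◂-∙ Φ σ τ) (trans (cong (_◂ τ) (p Φ)) (trans (q (Φ ◂ σ′)) (sym (◂-∙ Φ σ′ τ′))))
            }
          ; assoc = λ σ τ υ Φ → ◂-cong Φ ((σ A.∙ τ) A.∙ υ) (σ A.∙ (τ A.∙ υ)) (A.assoc σ τ υ)
          }
        ; identity = (λ σ Φ → ◂-cong Φ (A.ε A.∙ σ) σ (A.identityˡ σ)) , (λ σ Φ → ◂-cong Φ (σ A.∙ A.ε) σ (A.identityʳ σ))
        }
      ; inverse = inverseˡ′ , inverseʳ′
      ; ⁻¹-cong = λ {σ} {τ} p Φ → ◂-injective τ
          (trans (sym (p (Φ ◂ σ A.⁻¹))) (trans (cancel′ Φ σ) (sym (cancel′ Φ τ))))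
      }
    }
    where
    inverseˡ′ : ∀ σ Φ → Φ ◂ (σ A.⁻¹ A.∙ σ) ≡ Φ ◂ A.ε
    inverseˡ′ σ Φ = ◂-cong Φ (σ A.⁻¹ A.∙ σ) A.ε (A.inverseˡ σ)
    inverseʳ′ : ∀ σ Φ → Φ ◂ (σ A.∙ σ A.⁻¹) ≡ Φ ◂ A.ε
    inverseʳ′ σ Φ = ◂-cong Φ (σ A.∙ σ A.⁻¹) A.ε (A.inverseʳ σ)
    cancel′ : ∀ Φ σ → (Φ ◂ σ A.⁻¹) ◂ σ ≡ Φ
    cancel′ Φ σ = trans (sym (◂-∙ Φ (σ A.⁻¹) σ)) (trans (inverseˡ′ σ Φ) (◂-ε Φ))

  open Group flagGroup using () renaming (_≈_ to _≋_) public

  -- Automorphisms preserve j-adjacency and j-adjacent flags are unique, so agreement spreads along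
  -- a path of adjacent flags.
  ◂-free : ∀ {σ τ} → Φ ◂ σ ≡ Φ ◂ τ → σ ≋ τ
  ◂-free {Φ} {σ} {τ} eq Ψ = go (connected Φ Ψ) eq
    where
    go : ∀ {R : Flagₚ → Set} {X} → Star (λ X Y → (∃[ j ] X ~[ j ] Y) × R X × R Y) X Ψ →
      X ◂ σ ≡ X ◂ τ → Ψ ◂ σ ≡ Ψ ◂ τ
    go done                              eq = eq
    go (_◅_ {j = Y} ((j , p) , _) steps) eq =
      go steps (~-unique (~-◂ σ p) (subst (_~[ j ] Y ◂ τ) (sym eq) (~-◂ τ p)))

  module _ {i j : ℕ} (i<n : i ℕ.< n) (j<n : j ℕ.< n) (Φ : Flagₚ) where

    -- In exponent notation this is Φσ = Φ^{ji}: the j-face is exchanged first. A standard generator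
    -- σ_j has i = j - 1.
    Moves : Automorphism P → Set
    Moves σ = Φ ◂ σ ≡ adj i<n (adj j<n Φ)

  module _ {i j : ℕ} {i<n : i ℕ.< n} {j<n : j ℕ.< n} where

    -- Automorphisms commute with `adj`, so the second one acts on Φ inside the exchanges of the
    -- first, and the two middle exchanges cancel.
    moves-∙ : ∀ {k} {k<n : k ℕ.< n} {σ τ} → Moves i<n j<n Φ σ → Moves j<n k<n Φ τ → Moves i<n k<n Φ (σ A.∙ τ)
    moves-∙ {Φ} {k<n = k<n} {σ} {τ} p q = begin
      Φ ◂ (σ A.∙ τ)                                    ≡⟨ ◂-∙ Φ σ τ ⟩
      (Φ ◂ σ) ◂ τ                                      ≡⟨ cong (_◂ τ) p ⟩
      adj i<n (adj j<n Φ) ◂ τ                          ≡⟨ adj²-◂ τ ⟩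
      adj i<n (adj j<n (Φ ◂ τ))                        ≡⟨ cong (adj i<n ∘ adj j<n) q ⟩
      adj i<n (adj j<n (adj j<n (adj k<n Φ)))          ≡⟨ cong (adj i<n) (adj-involutive j<n) ⟩
      adj i<n (adj k<n Φ)                              ∎
      where
      open ≡.≡-Reasoning
      adj²-◂ : ∀ τ → adj i<n (adj j<n Φ) ◂ τ ≡ adj i<n (adj j<n (Φ ◂ τ))
      adj²-◂ τ = trans (adj-◂ i<n τ) (cong (adj i<n) (adj-◂ j<n τ))

    -- When the exchanges commute, σ also moves Φ with the indices swapped, and the product
    -- telescopes to the identity.
    moves-involutive : 2 + i ℕ.≤ j → ∀ {σ} → Moves i<n j<n Φ σ → σ A.∙ σ ≋ A.ε
    moves-involutive {Φ} 2+i≤j {σ} p = ◂-free {Φ} {σ A.∙ σ} {A.ε} (begin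
      Φ ◂ (σ A.∙ σ)                                    ≡⟨ moves-∙ {Φ} {k<n = i<n} {σ} {σ} p (trans p (adj-comm {Φ = Φ} i<n j<n 2+i≤j)) ⟩
      adj i<n (adj i<n Φ)                              ≡⟨ adj-involutive i<n ⟩
      Φ                                                ≡⟨ ◂-ε Φ ⟨
      Φ ◂ A.ε                                          ∎)
      where open ≡.≡-Reasoning

-- The order of a standard generator as the size of its section.

module Rotation {n : ℕ} (P : Polytope n) (chiral : IsChiral P) {k : ℕ} (1+k<n : 1 ℕ.+ k ℕ.< n)
  (Φ : Flag (Polytope.rankedPoset P)) (σ : Automorphism P) (generator : IsStandardGenerator P Φ (suc k) σ)
  {p : ℕ} (section : SectionFace (Polytope.rankedPoset P) (Flags.at P Φ k) (Flags.at P Φ (3 ℕ.+ k)) (1 ℕ.+ k) ↔ Fin p)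
  where

  open import Data.Nat.Base using (_+_)
  open Polytope P
  open Flags P
  open Group flagGroup using (_≈_; _∙_; ε; monoid)
  open import Algebra.Properties.Monoid.Mult monoid using (×-homo-+) renaming (_×_ to _times_)

  private
    k<n : k ℕ.< n
    k<n = ℕ.<-trans (ℕ.n<1+n k) 1+k<n

    3+k< : 3 + k ℕ.< 2 + n
    3+k< = s<s (s<s 1+k<n)

    2+k< : 2 + k ℕ.< 2 + n
    2+k< = ℕ.<-trans (ℕ.n<1+n _) 3+k<

    1+k< : 1 + k ℕ.< 2 + n
    1+k< = ℕ.<-trans (ℕ.n<1+n _) 2+k<

    k< : k ℕ.< 2 + n
    k< = ℕ.<-trans (ℕ.n<1+n _) 1+k<

    1+k≢2+k : 1 + k ≢ 2 + k
    1+k≢2+k = ℕ.<⇒≢ (ℕ.n<1+n _)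

    Φ⟨_⟩ : ℕ → Flagₚ
    Φ⟨ i ⟩ = Φ ◂ (i times σ)

  moves : Moves k<n 1+k<n Φ σ
  moves = trans (~⇒adj k<n (proj₂ (proj₂ generator))) (cong (adj k<n) (~⇒adj 1+k<n (proj₁ (proj₂ generator))))

  private
    Φ⟨0⟩ : Φ⟨ 0 ⟩ ≡ Φ
    Φ⟨0⟩ = ◂-ε Φ

    Φ⟨suc⟩ : ∀ i → Φ⟨ suc i ⟩ ≡ adj k<n (adj 1+k<n Φ⟨ i ⟩)
    Φ⟨suc⟩ i = begin
      Φ ◂ (σ ∙ i times σ)                         ≡⟨ ◂-∙ Φ σ (i times σ) ⟩
      (Φ ◂ σ) ◂ i times σ                         ≡⟨ cong (_◂ i times σ) moves ⟩
      adj k<n (adj 1+k<n Φ) ◂ i times σ           ≡⟨ adj-◂ k<n (i times σ) ⟩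
      adj k<n (adj 1+k<n Φ ◂ i times σ)           ≡⟨ cong (adj k<n) (adj-◂ 1+k<n (i times σ)) ⟩
      adj k<n (adj 1+k<n Φ⟨ i ⟩)                  ∎
      where open ≡.≡-Reasoning

    Φ⟨⟩-at : ∀ i {h} → h ℕ.< 2 + n → h ≢ 1 + k → h ≢ 2 + k → at Φ⟨ i ⟩ h ≡ at Φ h
    Φ⟨⟩-at zero    {h} h< h≢1 h≢2 = cong (λ X → at X h) Φ⟨0⟩
    Φ⟨⟩-at (suc i) {h} h< h≢1 h≢2 = begin
      at Φ⟨ suc i ⟩ h                         ≡⟨ cong (λ X → at X h) (Φ⟨suc⟩ i) ⟩
      at (adj k<n (adj 1+k<n Φ⟨ i ⟩)) h       ≡⟨ adj-at k<n h< h≢1 ⟩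
      at (adj 1+k<n Φ⟨ i ⟩) h                 ≡⟨ adj-at 1+k<n h< h≢2 ⟩
      at Φ⟨ i ⟩ h                             ≡⟨ Φ⟨⟩-at i h< h≢1 h≢2 ⟩
      at Φ h                                  ∎
      where open ≡.≡-Reasoning

    -- Chirality excludes that a power of σ fixing the k-face of Φ exchanges its (k + 1)-face.
    fixes⇒≈ε : ∀ m → at Φ⟨ m ⟩ (1 + k) ≡ at Φ (1 + k) → m times σ ≈ ε
    fixes⇒≈ε m fixes = ◂-free {Φ} {m times σ} {ε} (trans Φ⟨m⟩≡Φ (sym (◂-ε Φ)))
      where
      away : ∀ h → h ℕ.< 2 + n → h ≢ 2 + k → at Φ⟨ m ⟩ h ≡ at Φ h
      away h h< h≢2 with h ℕ.≟ 1 + k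
      ... | yes refl = fixes
      ... | no  h≢1  = Φ⟨⟩-at m h< h≢1 h≢2

      Φ⟨m⟩≡Φ : Φ⟨ m ⟩ ≡ Φ
      Φ⟨m⟩≡Φ with at Φ⟨ m ⟩ (2 + k) ≟ at Φ (2 + k)
      ... | no  at≢ = contradiction (m times σ , refl)
        (proj₂ chiral (1 + k) Φ Φ⟨ m ⟩
          (at⇒~ Φ≢Φ⟨m⟩ (λ h h< h≢ → sym (away h h< h≢))))
        where
        Φ≢Φ⟨m⟩ : Φ ≢ Φ⟨ m ⟩
        Φ≢Φ⟨m⟩ eq = at≢ (cong (λ X → at X (2 + k)) (sym eq))
      ... | yes ≡₂ = flag-ext same
        where
        same : ∀ h → h ℕ.< 2 + n → at Φ⟨ m ⟩ h ≡ at Φ h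
        same h h< with h ℕ.≟ 2 + k
        ... | yes refl = ≡₂
        ... | no  h≢2  = away h h< h≢2

    rotated : ℕ → SectionFace rankedPoset (at Φ k) (at Φ (3 + k)) (1 + k)
    rotated i = mkSectionFace (at Φ⟨ i ⟩ (1 + k))
      (subst (_≤ at Φ⟨ i ⟩ (1 + k)) (Φ⟨⟩-at i k< (ℕ.<⇒≢ (ℕ.n<1+n k)) (ℕ.<⇒≢ (ℕ.m<n+m k {2} z<s))) (at-≤ Φ⟨ i ⟩ 1+k<))
      (subst (at Φ⟨ i ⟩ (1 + k) ≤_) (Φ⟨⟩-at i 3+k< (ℕ.<⇒≢ (ℕ.m<n+m (1 + k) {2} z<s) ∘ sym) (ℕ.<⇒≢ (ℕ.n<1+n _) ∘ sym))
        (≤-trans (at-≤ Φ⟨ i ⟩ 2+k<) (at-≤ Φ⟨ i ⟩ 3+k<)))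
      (height-at Φ⟨ i ⟩ 1+k<)

  -- Two of the p + 1 first rotations of the base face coincide. Cancelling the smaller one leaves a
  -- power of σ that fixes this face, hence is trivial.
  period : ∃[ m ] 0 ℕ.< m × m ℕ.≤ p × m times σ ≈ ε
  period with i , j , i<j , eq ← Fin.pigeonhole (ℕ.n<1+n p) (λ i → Inverse.to section (rotated (toℕ i))) =
    m , ℕ.m<n⇒0<n∸m i<j , ℕ.≤-trans (ℕ.m∸n≤m (toℕ j) (toℕ i)) (ℕ.≤-pred (Fin.toℕ<n j)) , fixes⇒≈ε m fixes
    where
    m : ℕ
    m = toℕ j ∸ toℕ i

    to : Automorphism P → Face → Face
    to = Automorphism.to

    Φ⟨j⟩ : Φ⟨ toℕ j ⟩ ≡ Φ⟨ m ⟩ ◂ (toℕ i times σ)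
    Φ⟨j⟩ = begin
      Φ⟨ toℕ j ⟩                           ≡⟨ cong Φ⟨_⟩ (sym (ℕ.m∸n+n≡m (ℕ.<⇒≤ i<j))) ⟩
      Φ⟨ m + toℕ i ⟩                       ≡⟨ ×-homo-+ σ m (toℕ i) Φ ⟩
      Φ ◂ (m times σ ∙ toℕ i times σ)      ≡⟨ ◂-∙ Φ (m times σ) (toℕ i times σ) ⟩
      Φ⟨ m ⟩ ◂ (toℕ i times σ)             ∎
      where open ≡.≡-Reasoning

    fixes : at Φ⟨ m ⟩ (1 + k) ≡ at Φ (1 + k)
    fixes = ↔-injective (Automorphism.bijection (toℕ i times σ)) (begin
      to (toℕ i times σ) (at Φ⟨ m ⟩ (1 + k))     ≡⟨ at-◂ Φ⟨ m ⟩ (toℕ i times σ) 1+k< ⟨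
      at (Φ⟨ m ⟩ ◂ (toℕ i times σ)) (1 + k)      ≡⟨ cong (λ X → at X (1 + k)) Φ⟨j⟩ ⟨
      at Φ⟨ toℕ j ⟩ (1 + k)                      ≡⟨ cong SectionFace.face (↔-injective section eq) ⟨
      at Φ⟨ toℕ i ⟩ (1 + k)                      ≡⟨ at-◂ Φ (toℕ i times σ) 1+k< ⟩
      to (toℕ i times σ) (at Φ (1 + k))          ∎)
      where open ≡.≡-Reasoning

  module _ {m : ℕ} (m≈ε : suc m times σ ≈ ε) where

    private
      -- The flags of the section, as an orbit of ⟨σ⟩ on Φ and on its (k + 1)-adjacent flag.
      data Reached (X : Flagₚ) : Set where
        even : ∀ i → i ℕ.< suc m → X ≡ Φ⟨ i ⟩ → Reached X
        odd  : ∀ i → i ℕ.< suc m → X ≡ adj 1+k<n Φ⟨ i ⟩ → Reached X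

      successor : ∀ i → i ℕ.< suc m → Reached Φ⟨ suc i ⟩
      successor i i< with ℕ.m≤n⇒m<n∨m≡n i<
      ... | inj₁ i+1< = even (suc i) i+1< refl
      ... | inj₂ refl = even 0 z<s (m≈ε Φ)

      adj-k-Φ⟨suc⟩ : ∀ i → adj k<n Φ⟨ suc i ⟩ ≡ adj 1+k<n Φ⟨ i ⟩
      adj-k-Φ⟨suc⟩ i = trans (cong (adj k<n) (Φ⟨suc⟩ i)) (adj-involutive k<n)

      reached-adj-k : ∀ {X} → Reached X → Reached (adj k<n X)
      -- Stepping back from exponent 0 wraps around to m, as Φ is also Φσ^(m+1).
      reached-adj-k (even zero    i< refl) = odd m (ℕ.n<1+n m) (trans (cong (adj k<n) (sym (m≈ε Φ))) (adj-k-Φ⟨suc⟩ m))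
      reached-adj-k (even (suc i) i< refl) = odd i (ℕ.<-trans (ℕ.n<1+n i) i<) (adj-k-Φ⟨suc⟩ i)
      reached-adj-k (odd i i< refl) = subst Reached (Φ⟨suc⟩ i) (successor i i<)

      reached-adj-1+k : ∀ {X} → Reached X → Reached (adj 1+k<n X)
      reached-adj-1+k (even i i< refl) = odd i i< refl
      reached-adj-1+k (odd i i< refl)  = even i i< (adj-involutive 1+k<n)

      module _ (Ψ : Flagₚ) (Ψ-at : ∀ h → h ℕ.< 2 + n → h ≢ 1 + k → h ≢ 2 + k → at Ψ h ≡ at Φ h) where

        meet-at : ∀ {X h} → h ℕ.< 2 + n → h ≢ 1 + k → h ≢ 2 + k → ContainsMeet rankedPoset Φ Ψ X → at X h ≡ at Φ h
        meet-at {X} {h} h< h≢1 h≢2 meet = sym (∈-at X (meet (at Φ h) (at-∈ Φ h<)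
          (subst (_∈ Flag.faces Ψ) (Ψ-at h h< h≢1 h≢2) (at-∈ Ψ h<))) (height-at Φ h<))

        -- All flags on the path contain the faces common to Φ and Ψ, so only heights 1 + k and 2 +
        -- k can change, and both exchanges preserve `Reached`.
        reached-step : ∀ {X Y j} → X ~[ j ] Y → ContainsMeet rankedPoset Φ Ψ X → ContainsMeet rankedPoset Φ Ψ Y →
          Reached X → Reached Y
        reached-step {X} {Y} {j} X~Y X⊇ Y⊇ r with j ℕ.≟ k | j ℕ.≟ 1 + k
        ... | yes refl | _        = subst Reached (sym (~⇒adj k<n X~Y)) (reached-adj-k r)
        ... | no  _    | yes refl = subst Reached (sym (~⇒adj 1+k<n X~Y)) (reached-adj-1+k r)
        ... | no  j≢k  | no  j≢1+k = contradiction
          (trans (meet-at {X} 1+j< j≢₁ j≢₂ X⊇) (sym (meet-at {Y} 1+j< j≢₁ j≢₂ Y⊇))) (~⇒at≢ X~Y)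
          where
          1+j< : 1 + j ℕ.< 2 + n
          1+j< = s<s (ℕ.<-trans (~⇒< X~Y) (ℕ.n<1+n n))
          j≢₁ : 1 + j ≢ 1 + k
          j≢₁ = j≢k ∘ ℕ.suc-injective
          j≢₂ : 1 + j ≢ 2 + k
          j≢₂ = j≢1+k ∘ ℕ.suc-injective

        reached : Reached Ψ
        reached = go (connected Φ Ψ) (even 0 z<s (sym Φ⟨0⟩))
          where
          go : ∀ {X} → Star (λ X Y → (∃[ j ] X ~[ j ] Y) × ContainsMeet rankedPoset Φ Ψ X ×
            ContainsMeet rankedPoset Φ Ψ Y) X Ψ → Reached X → Reached Ψ
          go done r = r
          go (((_ , X~Y) , X⊇ , Y⊇) ◅ steps) r = go steps (reached-step X~Y X⊇ Y⊇ r)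

      module _ (H : Face) (lower : at Φ k ≤ H) (upper : H ≤ at Φ (3 + k)) (level : height H ≡ 1 + k) where

        -- The diamond condition supplies a face above `H`, completing it to a flag that agrees with
        -- Φ outside the section.
        filler : ∃[ K ] Between H K (at Φ (3 + k))
        filler = section-face upper (trans (height-at Φ 3+k<) (cong (suc ∘ suc) (sym level)))

        f : ℕ → Face
        f h with h ℕ.≟ 1 + k | h ℕ.≟ 2 + k
        ... | yes _ | _     = H
        ... | no  _ | yes _ = proj₁ filler
        ... | no  _ | no  _ = at Φ h

        height-f : ∀ h → h ℕ.< 2 + n → height (f h) ≡ h
        height-f h h< with h ℕ.≟ 1 + k | h ℕ.≟ 2 + k
        ... | yes refl | _        = level
        ... | no  _    | yes refl = trans (Between.level (proj₂ filler)) (cong suc level)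
        ... | no  _    | no  _    = height-at Φ h<

        f-step : ∀ h → suc h ℕ.< 2 + n → f h ≤ f (suc h)
        f-step h h< with h ℕ.≟ 1 + k | h ℕ.≟ 2 + k | suc h ℕ.≟ 1 + k | suc h ℕ.≟ 2 + k
        ... | yes refl | _        | no  _    | yes _    = Between.lower (proj₂ filler)
        ... | yes refl | _        | no  _    | no  h≢   = contradiction refl h≢
        ... | no  _    | yes refl | no  _    | no  _    = Between.upper (proj₂ filler)
        ... | no  ≢1   | no  _    | no  _    | yes eq   = contradiction (ℕ.suc-injective eq) ≢1
        ... | no  _    | no  _    | yes refl | _        = lower
        ... | no  _    | no  _    | no  _    | no  _    = at-≤ Φ h<

        open FromFaces f height-f f-step

        flag-at : ∀ h → h ℕ.< 2 + n → h ≢ 1 + k → h ≢ 2 + k → at flag h ≡ at Φ h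
        flag-at h h< h≢1 h≢2 = trans (at-flag h<) f-away
          where
          f-away : f h ≡ at Φ h
          f-away with h ℕ.≟ 1 + k | h ℕ.≟ 2 + k
          ... | yes ≡₁ | _      = contradiction ≡₁ h≢1
          ... | no  _  | yes ≡₂ = contradiction ≡₂ h≢2
          ... | no  _  | no  _  = refl

        flag-1+k : at flag (1 + k) ≡ H
        flag-1+k = trans (at-flag 1+k<) f-1+k
          where
          f-1+k : f (1 + k) ≡ H
          f-1+k with (1 + k) ℕ.≟ (1 + k)
          ... | yes _ = refl
          ... | no  1+k≢ = contradiction refl 1+k≢

        rotation-of : ∃[ i ] i ℕ.< suc m × H ≡ at Φ⟨ i ⟩ (1 + k)
        rotation-of with reached flag flag-at
        ... | even i i< eq = i , i< , trans (sym flag-1+k) (cong (λ X → at X (1 + k)) eq)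
        -- The odd flags give no further faces: the (1 + k)-exchange leaves height 1 + k alone.
        ... | odd i i< eq  = i , i< , trans (sym flag-1+k)
          (trans (cong (λ X → at X (1 + k)) eq) (adj-at 1+k<n 1+k< 1+k≢2+k))

      transitive : ∀ S → ∃[ i ] i ℕ.< suc m × S ≡ rotated i
      transitive (mkSectionFace H lower upper level) = proj₁ r , proj₁ (proj₂ r) , section-≡ (proj₂ (proj₂ r))
        where
        r : ∃[ i ] i ℕ.< suc m × H ≡ at Φ⟨ i ⟩ (1 + k)
        r = rotation-of H (recompute (at Φ k ≤? H) lower) (recompute (H ≤? at Φ (3 + k)) upper)
          (recompute (height H ℕ.≟ 1 + k) level)

    -- The p faces of the section are all among the m + 1 rotations of the base face.
    p≤period : p ℕ.≤ suc m
    p≤period = Fin.injective⇒≤ {f = index} index-injective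
      where
      open ≡.≡-Reasoning

      exponent : Fin p → ℕ
      exponent x = proj₁ (transitive (Inverse.from section x))

      exponent< : ∀ x → exponent x ℕ.< suc m
      exponent< x = proj₁ (proj₂ (transitive (Inverse.from section x)))

      to-rotated : ∀ x → Inverse.to section (rotated (exponent x)) ≡ x
      to-rotated x = trans (cong (Inverse.to section) (sym (proj₂ (proj₂ (transitive (Inverse.from section x))))))
        (Inverse.strictlyInverseˡ section x)

      index : Fin p → Fin (suc m)
      index x = fromℕ< (exponent< x)

      index-injective : ∀ {x y} → index x ≡ index y → x ≡ y
      index-injective {x} {y} eq = begin
        x                                            ≡⟨ to-rotated x ⟨
        Inverse.to section (rotated (exponent x))    ≡⟨ cong (Inverse.to section ∘ rotated)
                                                          (Fin.fromℕ<-injective _ _ (exponent< x) (exponent< y) eq) ⟩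
        Inverse.to section (rotated (exponent y))    ≡⟨ to-rotated y ⟩
        y                                            ∎

  order≥ : ∀ m → 0 ℕ.< m → m times σ ≈ ε → p ℕ.≤ m
  order≥ (suc m) _ m≈ε = p≤period m≈ε

  p-times≈ε : p times σ ≈ ε
  p-times≈ε = go period
    where
    go : ∃[ m ] 0 ℕ.< m × m ℕ.≤ p × m times σ ≈ ε → p times σ ≈ ε
    go (m , 0<m , m≤p , m≈ε) = subst (λ i → i times σ ≈ ε) (ℕ.≤-antisym m≤p (order≥ m 0<m m≈ε)) m≈ε

-- The relations and orders of standard generators in rank 4.

module StandardRelations (P : Polytope 4) (chiral : IsChiral P) (ps : Vec ℕ 3) (type : HasType P ps)
  (Φ : Flag (Polytope.rankedPoset P)) (σ₁ σ₂ σ₃ : Automorphism P) (generators : StandardGenerators P Φ σ₁ σ₂ σ₃) where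

  open Polytope P using (rankedPoset; ≤-trans)
  open Flags P
  open Group flagGroup
  open import Algebra.Properties.Monoid.Mult monoid using () renaming (_×_ to _times_)

  private
    1+i<4 : (i : Fin 3) → 1 ℕ.+ toℕ i ℕ.< 4
    1+i<4 0F = s≤s (s≤s z≤n)
    1+i<4 1F = s≤s (s≤s (s≤s z≤n))
    1+i<4 2F = s≤s (s≤s (s≤s (s≤s z≤n)))

    section : ∀ i → SectionFace rankedPoset (at Φ (toℕ i)) (at Φ (3 ℕ.+ toℕ i)) (1 ℕ.+ toℕ i) ↔ Fin (lookup ps i)
    section i = subst (λ h → SectionFace rankedPoset (at Φ (toℕ i)) (at Φ (3 ℕ.+ toℕ i)) (1 ℕ.+ h) ↔ Fin (lookup ps i))
      (height-at Φ i<) (proj₁ (type i _ _ (≤-trans (at-≤ Φ 1+i<) (≤-trans (at-≤ Φ 2+i<) (at-≤ Φ 3+i<)))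
        (height-at Φ i<) (height-at Φ 3+i<)))
      where
      3+i< : 3 ℕ.+ toℕ i ℕ.< 6
      3+i< = s≤s (s≤s (1+i<4 i))
      2+i< : 2 ℕ.+ toℕ i ℕ.< 6
      2+i< = ℕ.<-trans (ℕ.n<1+n _) 3+i<
      1+i< : 1 ℕ.+ toℕ i ℕ.< 6
      1+i< = ℕ.<-trans (ℕ.n<1+n _) 2+i<
      i< : toℕ i ℕ.< 6
      i< = ℕ.<-trans (ℕ.n<1+n _) 1+i<

    module R₁ = Rotation P chiral (1+i<4 0F) Φ σ₁ (proj₁ generators) (section 0F)
    module R₂ = Rotation P chiral (1+i<4 1F) Φ σ₂ (proj₁ (proj₂ generators)) (section 1F)
    module R₃ = Rotation P chiral (1+i<4 2F) Φ σ₃ (proj₂ (proj₂ generators)) (section 2F)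

    moves₁₂ : Moves _ _ Φ (σ₁ ∙ σ₂)
    moves₁₂ = moves-∙ {Φ = Φ} {σ = σ₁} {τ = σ₂} R₁.moves R₂.moves

    moves₂₃ : Moves _ _ Φ (σ₂ ∙ σ₃)
    moves₂₃ = moves-∙ {Φ = Φ} {σ = σ₂} {τ = σ₃} R₂.moves R₃.moves

    moves₁₂₃ : Moves _ _ Φ ((σ₁ ∙ σ₂) ∙ σ₃)
    moves₁₂₃ = moves-∙ {Φ = Φ} {σ = σ₁ ∙ σ₂} {τ = σ₃} moves₁₂ R₃.moves

  -- The three products move Φ by the index pairs (0, 2), (1, 3) and (0, 3), all at distance at
  -- least 2, so each is an involution or trivial.
  [σ₁σ₂]²≈ε : (σ₁ ∙ σ₂) ∙ (σ₁ ∙ σ₂) ≈ ε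
  [σ₁σ₂]²≈ε = moves-involutive {Φ = Φ} ℕ.≤-refl {σ₁ ∙ σ₂} moves₁₂

  [σ₂σ₃]²≈ε : (σ₂ ∙ σ₃) ∙ (σ₂ ∙ σ₃) ≈ ε
  [σ₂σ₃]²≈ε = moves-involutive {Φ = Φ} ℕ.≤-refl {σ₂ ∙ σ₃} moves₂₃

  [σ₁σ₂σ₃]²≈ε : ((σ₁ ∙ σ₂) ∙ σ₃) ∙ ((σ₁ ∙ σ₂) ∙ σ₃) ≈ ε
  [σ₁σ₂σ₃]²≈ε = moves-involutive {Φ = Φ} (ℕ.n≤1+n 2) {(σ₁ ∙ σ₂) ∙ σ₃} moves₁₂₃

  σ₂-order : lookup ps 1F times σ₂ ≈ ε
  σ₂-order = R₂.p-times≈ε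

  σ₂-order-minimal : ∀ m → 0 ℕ.< m → m times σ₂ ≈ ε → lookup ps 1F ℕ.≤ m
  σ₂-order-minimal = R₂.order≥

  σ₃-order : lookup ps 2F times σ₃ ≈ ε
  σ₃-order = R₃.p-times≈ε

module _ {n : ℕ} (P : Polytope n) where
  open Flags P
  private
    module A = Group (automorphismGroup P)
    module F = Group flagGroup
    module Aᶻ = IntegerPower (automorphismGroup P)
    module Fᶻ = IntegerPower flagGroup
    open import Algebra.Definitions.RawMonoid A.rawMonoid using () renaming (_×_ to _timesᴬ_)
    open import Algebra.Definitions.RawMonoid F.rawMonoid using () renaming (_×_ to _timesᶠ_)

    times-≡ : ∀ k σ → k timesᴬ σ ≡ k timesᶠ σ
    times-≡ zero    σ = refl
    times-≡ (suc k) σ = cong (σ A.∙_) (times-≡ k σ)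

  -- The two groups share their operations and differ only in `_≈_`, so powers agree even up to
  -- `_≡_`.
  ^ᶻ-flagGroup : ∀ σ i → σ Aᶻ.^ᶻ i ≡ σ Fᶻ.^ᶻ i
  ^ᶻ-flagGroup σ (+ k)    = times-≡ k σ
  ^ᶻ-flagGroup σ -[1+ k ] = cong A._⁻¹ (times-≡ (suc k) σ)

  ≈⇒≋ : ∀ σ {τ τ′} → σ A.≈ τ → τ ≡ τ′ → σ ≋ τ′
  ≈⇒≋ σ {τ} σ≈τ refl Φ = ◂-cong Φ σ τ σ≈τ

open Defs
open import Data.Integer.Base using (-_; _+_; _-_; _*_)
open import Data.Nat.Base using (_≤_)

theorem5p12 : ∀ (β : ℕ) (ε₁ ε₂ : ℤ) → 5 ≤ β → ε₁ ≡ 0ℤ ⊎ ε₁ ≡ 1ℤ → ε₂ ≡ 1ℤ ⊎ ε₂ ≡ -1ℤ →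
  NoTightChiral (2 ^ (β ∸ 1) ∷ 2 ^ β ∷ 8 ∷ [])
    (λ P σ₁ σ₂ σ₃ →
      (σ₂ ∙ σ₁ ⁻¹ ≈ σ₁ ∙ σ₂ ^ᶻ (+ 3 - ε₁ * + (2 ^ (β ∸ 1)))) ×
      (σ₂ ∙ σ₃ ^ᶻ (+ 2) ≈ σ₃ ^ᶻ (+ 2) ∙ σ₂ ^ᶻ (+ 1 + ε₂ * + (2 ^ (β ∸ 2)))))
  ×
  NoTightChiral (2 ^ (β ∸ 1) ∷ 2 ^ β ∷ 2 ^ (β ∸ 1) ∷ [])
    (λ P σ₁ σ₂ σ₃ →
      (σ₂ ∙ σ₁ ⁻¹ ≈ σ₁ ∙ σ₂ ^ᶻ (+ 3 - ε₁ * + (2 ^ (β ∸ 1)))) ×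
      (σ₃ ⁻¹ ∙ σ₂ ≈ σ₂ ^ᶻ (+ 3 + ε₂ * + (2 ^ (β ∸ 2))) ∙ σ₃ ^ᶻ (+ 1 - + (2 ^ (β ∸ 2)))) ×
      (σ₃ ∙ σ₂ ⁻¹ ≈ σ₂ ^ᶻ (- (+ 3) + ε₂ * + (2 ^ (β ∸ 2))) ∙ σ₃ ^ᶻ (- (+ 1) + + (2 ^ (β ∸ 2)))))
theorem5p12 (suc (suc (suc (suc (suc n))))) ε₁ ε₂ (s≤s (s≤s (s≤s (s≤s (s≤s z≤n))))) ε₁∈ ε₂∈ =
  (λ (P , chiral , (type , _) , Φ , σ₁ , σ₂ , σ₃ , generators , ba⁻¹ , bc²) →
    let open Flags P using (flagGroup)
        module S = StandardRelations P chiral (2 ^ (4 ℕ.+ n) ∷ 2 ^ (5 ℕ.+ n) ∷ 8 ∷ []) type Φ σ₁ σ₂ σ₃ generators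
        module E = Exponents flagGroup n ε₁ ε₂ ε₁∈ ε₂∈ σ₁ σ₂ σ₃ S.σ₂-order
          S.[σ₁σ₂]²≈ε S.[σ₂σ₃]²≈ε S.[σ₁σ₂σ₃]²≈ε
          (≈⇒≋ P (σ₂ ∙ σ₁ ⁻¹) ba⁻¹ (cong (σ₁ ∙_) (^ᶻ-flagGroup P σ₂ (+ 3 - ε₁ * + (2 ^ (4 ℕ.+ n))))))
    -- The order 2^β of σ₂ cannot be at most 2^(β-1), the exponent annihilated by the relations.
    in 2^[1+k]≰2^k (4 ℕ.+ n) (S.σ₂-order-minimal (2 ^ (4 ℕ.+ n)) (ℕ.m^n>0 2 (4 ℕ.+ n))
      (E.b^2^[β-1]≈ε-a S.σ₃-order (≈⇒≋ P (σ₂ ∙ σ₃ ^ᶻ (+ 2)) bc² (cong (σ₃ ^ᶻ (+ 2) ∙_)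
        (^ᶻ-flagGroup P σ₂ (+ 1 + ε₂ * N)))))))
  ,
  (λ (P , chiral , (type , _) , Φ , σ₁ , σ₂ , σ₃ , generators , ba⁻¹ , c⁻¹b , cb⁻¹) →
    let open Flags P using (flagGroup)
        module S = StandardRelations P chiral (2 ^ (4 ℕ.+ n) ∷ 2 ^ (5 ℕ.+ n) ∷ 2 ^ (4 ℕ.+ n) ∷ []) type Φ σ₁ σ₂ σ₃ generators
        module E = Exponents flagGroup n ε₁ ε₂ ε₁∈ ε₂∈ σ₁ σ₂ σ₃ S.σ₂-order
          S.[σ₁σ₂]²≈ε S.[σ₂σ₃]²≈ε S.[σ₁σ₂σ₃]²≈ε
          (≈⇒≋ P (σ₂ ∙ σ₁ ⁻¹) ba⁻¹ (cong (σ₁ ∙_) (^ᶻ-flagGroup P σ₂ (+ 3 - ε₁ * + (2 ^ (4 ℕ.+ n))))))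
    in 2^[1+k]≰2^k (4 ℕ.+ n) (S.σ₂-order-minimal (2 ^ (4 ℕ.+ n)) (ℕ.m^n>0 2 (4 ℕ.+ n))
      (E.b^2^[β-1]≈ε-b S.σ₃-order
        (≈⇒≋ P (σ₃ ⁻¹ ∙ σ₂) c⁻¹b (cong₂ _∙_ (^ᶻ-flagGroup P σ₂ (+ 3 + ε₂ * N)) (^ᶻ-flagGroup P σ₃ (+ 1 - N))))
        (≈⇒≋ P (σ₃ ∙ σ₂ ⁻¹) cb⁻¹ (cong₂ _∙_ (^ᶻ-flagGroup P σ₂ (- (+ 3) + ε₂ * N)) (^ᶻ-flagGroup P σ₃ (- (+ 1) + N)))))))
  where
  N : ℤ
  N = + (2 ^ (3 ℕ.+ n))

  2^[1+k]≰2^k : ∀ k → ¬ (2 ^ suc k ≤ 2 ^ k)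
  2^[1+k]≰2^k k = ℕ.<⇒≱ (ℕ.^-monoʳ-< 2 (s≤s (s≤s z≤n)) (ℕ.n<1+n k))
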